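{- Consider the following random graph process: start with two vertices joined by an edge; at each time step choose an edge $\{u,w\}$ of the current graph uniformly at random, add a new vertex $v$, and add the edges $\{v,u\}$ and $\{v,w\}$. Let $C_n$ denote the average over all vertices of the local clustering coefficient of the graph at the time it has $n$ vertices ($n\ge 3$). Then the limiting average local clustering coefficient is $2\pi^2-19$, i.e. $$\lim_{n\to\infty}\mathbb{E}[C_n]=2\pi^2-19 .$$
   Context: The local clustering coefficient of a vertex $i$ of degree $d_i\ge 2$ in a simple graph is $\dfrac{2E_i}{d_i(d_i-1)}$, where $E_i$ is the number of edges among the neighbors of $i$. The process is Algorithm SE-A of the paper with parameter $z=1$ and initial graph consisting of two connected vertices. -}

module Defs where

open import Data.Empty using (⊥)
open import Data.Fin as Fin using (Fin; fromℕ; inject₁)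
import Data.Fin.Properties as Fin
open import Data.Integer as ℤ using (+_; -1ℤ)
import Data.Integer.Properties as ℤ
open import Data.List as List using (List; []; _∷_; allFin; concatMap; filter; foldr; length; map)
import Data.List.NonEmpty as List⁺
open import Data.List.NonEmpty using (List⁺; _∷_; toList)
open import Data.List.Relation.Unary.All as All using (All; []; _∷_)
import Data.List.Relation.Unary.All.Properties as All
open import Data.List.Relation.Unary.AllPairs using ([]; _∷_)
open import Data.List.Relation.Unary.Any using (Any; any?)
open import Data.List.Relation.Unary.Unique.Propositional using (Unique)
import Data.List.Relation.Unary.Unique.Propositional.Properties as Unique
open import Data.Nat as ℕ using (ℕ; zero; suc; _≥_)
import Data.Nat.Properties as ℕ
open import Data.Product using (_×_; _,_; ∃; proj₁; proj₂)
open import Data.Rational as ℚ using (ℚ; _/_; 0ℚ; 1ℚ)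
import Data.Rational.Properties as ℚ
open import Data.Rational.Solver using (module +-*-Solver)
import Data.Rational.Unnormalised as ℚᵘ
import Data.Rational.Unnormalised.Properties as ℚᵘ
open import Data.Sum using (_⊎_; inj₁; inj₂)
open import Relation.Binary.PropositionalEquality
open import Relation.Nullary using (Dec)
open import Relation.Nullary.Decidable using (_×-dec_; _⊎-dec_)

------------------------------------------------------------------------
-- Simple graphs

-- An unordered pair of distinct vertices, written with its smaller end first.
-- The ordering proof is irrelevant, so equal ends make equal edges.
record Edge (n : ℕ) : Set where
  constructor edge
  field
    end₁ end₂ : Fin n
    .end₁<end₂ : end₁ Fin.< end₂

open Edge public

record Graph (n : ℕ) : Set where
  field
    edges  : List⁺ (Edge n)
    unique : Unique (toList edges)

open Graph public

Joins : ∀ {n} → Fin n → Fin n → Edge n → Set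
Joins i j e = (i ≡ end₁ e × j ≡ end₂ e) ⊎ (i ≡ end₂ e × j ≡ end₁ e)

joins? : ∀ {n} (i j : Fin n) (e : Edge n) → Dec (Joins i j e)
joins? i j e = ((i Fin.≟ end₁ e) ×-dec (j Fin.≟ end₂ e))
         ⊎-dec ((i Fin.≟ end₂ e) ×-dec (j Fin.≟ end₁ e))

Adjacent : ∀ {n} → Graph n → Fin n → Fin n → Set
Adjacent G i j = Any (Joins i j) (toList (edges G))

adjacent? : ∀ {n} (G : Graph n) (i j : Fin n) → Dec (Adjacent G i j)
adjacent? G i j = any? (joins? i j) (toList (edges G))

degree : ∀ {n} → Graph n → Fin n → ℕ
degree {n} G i = length (filter (adjacent? G i) (allFin n))

edgesAmongNeighbours : ∀ {n} → Graph n → Fin n → ℕ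
edgesAmongNeighbours G i =
  length (filter (λ e → adjacent? G i (end₁ e) ×-dec adjacent? G i (end₂ e))
                 (toList (edges G)))

∑ : ∀ {A : Set} → (A → ℚ) → List A → ℚ
∑ f xs = foldr ℚ._+_ 0ℚ (map f xs)

-- 2 E / (d (d - 1)), with the value 0 when d < 2.
clusteringFormula : (d E : ℕ) → ℚ
clusteringFormula zero          E = 0ℚ
clusteringFormula (suc zero)    E = 0ℚ
clusteringFormula (suc (suc k)) E = + (2 ℕ.* E) / (suc (suc k) ℕ.* suc k)

localClustering : ∀ {n} → Graph n → Fin n → ℚ
localClustering G i = clusteringFormula (degree G i) (edgesAmongNeighbours G i)

averageClustering : ∀ {n} .{{_ : ℕ.NonZero n}} → Graph n → ℚ
averageClustering {n} G = ∑ (localClustering G) (allFin n) ℚ.* (+ 1 / n)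

------------------------------------------------------------------------
-- Finitely supported probability distributions with rational weights

-- A list of outcomes with their weights; an outcome may be listed repeatedly.
Dist : Set → Set
Dist A = List (A × ℚ)

return : ∀ {A} → A → Dist A
return x = (x , 1ℚ) ∷ []

infixl 1 _>>=_

_>>=_ : ∀ {A B} → Dist A → (A → Dist B) → Dist B
μ >>= κ = concatMap (λ (x , p) → map (λ (y , q) → y , p ℚ.* q) (κ x)) μ

uniform : ∀ {A} → List⁺ A → Dist A
uniform xs = map (λ x → x , + 1 / List⁺.length xs) (toList xs)

𝔼 : ∀ {A} → (A → ℚ) → Dist A → ℚ
𝔼 f μ = ∑ (λ (x , p) → p ℚ.* f x) μ

------------------------------------------------------------------------
-- The random graph process

singleEdge : Graph 2
singleEdge = record
  { edges  = edge Fin.zero (Fin.suc Fin.zero) (ℕ.s≤s ℕ.z≤n) ∷ []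
  ; unique = [] ∷ []
  }

oldEdge : ∀ {n} → Edge n → Edge (suc n)
oldEdge (edge u w u<w) = edge (inject₁ u) (inject₁ w)
  (subst₂ ℕ._<_ (sym (Fin.toℕ-inject₁ u)) (sym (Fin.toℕ-inject₁ w)) u<w)

-- The edge joining an old vertex to the new vertex  fromℕ n.
newEdge : ∀ {n} → Fin n → Edge (suc n)
newEdge {n} u = edge (inject₁ u) (fromℕ n)
  (subst (Fin.toℕ (inject₁ u) ℕ.<_) (sym (Fin.toℕ-fromℕ n)) (Fin.inject₁ℕ< u))

oldEdge-injective : ∀ {n} {e f : Edge n} → oldEdge e ≡ oldEdge f → e ≡ f
oldEdge-injective {e = edge u w _} {edge u′ w′ _} eq
  with refl ← Fin.inject₁-injective {i = u} {u′} (cong end₁ eq)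
     | refl ← Fin.inject₁-injective {i = w} {w′} (cong end₂ eq) = refl

newEdge≢oldEdge : ∀ {n} {u : Fin n} (e : Edge n) → newEdge u ≢ oldEdge e
newEdge≢oldEdge e eq = Fin.fromℕ≢inject₁ (cong end₂ eq)

newEdge-distinct : ∀ {n} (e : Edge n) → newEdge (end₁ e) ≢ newEdge (end₂ e)
newEdge-distinct (edge u w u<w) eq
  with refl ← Fin.inject₁-injective {i = u} {w} (cong end₁ eq) = irr (ℕ.<-irrefl refl u<w)
  where
  irr : ∀ {A : Set} → .⊥ → A
  irr ()

attach : ∀ {n} → Graph n → Edge n → Graph (suc n)
attach G e = record
  { edges  = newEdge (end₁ e) ∷ newEdge (end₂ e) ∷ map oldEdge (toList (edges G))
  ; unique = (newEdge-distinct e ∷ fresh) ∷ fresh ∷ Unique.map⁺ oldEdge-injective (unique G)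
  }
  where
  fresh : ∀ {u} → All (newEdge u ≢_) (map oldEdge (toList (edges G)))
  fresh = All.map⁺ (All.universal newEdge≢oldEdge (toList (edges G)))

-- The law of the graph after t steps, when it has 2 + t vertices.
process : ∀ t → Dist (Graph (2 ℕ.+ t))
process zero    = return singleEdge
process (suc t) = process t >>= λ G →
                  uniform (edges G) >>= λ e →
                  return (attach G e)

------------------------------------------------------------------------
-- Real numbers as Cauchy sequences of rationals

IsCauchy : (ℕ → ℚ) → Set
IsCauchy x = ∀ ε → ε ℚ.> 0ℚ → ∃ λ N → ∀ m n → m ≥ N → n ≥ N → ℚ.∣ x m ℚ.- x n ∣ ℚ.< ε

record ℝ : Set where
  constructor real
  field
    approx : ℕ → ℚ
    cauchy : IsCauchy approx

open ℝ public

open +-*-Solver using (solve; _:+_; _:*_; _:-_; :-_; _:=_; con)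

module Bounds where
  half : ∀ ε → ε ℚ.> 0ℚ → ε ℚ.* ℚ.½ ℚ.> 0ℚ
  half ε ε>0 = subst (ℚ._< ε ℚ.* ℚ.½) (ℚ.*-zeroˡ ℚ.½) (ℚ.*-monoˡ-<-pos ℚ.½ ε>0)

  half+half : ∀ ε → ε ℚ.* ℚ.½ ℚ.+ ε ℚ.* ℚ.½ ≡ ε
  half+half ε = trans (sym (ℚ.*-distribˡ-+ ε ℚ.½ ℚ.½)) (ℚ.*-identityʳ ε)

  p≤∣p∣ : ∀ p → p ℚ.≤ ℚ.∣ p ∣
  p≤∣p∣ p with ℚ.≤-total 0ℚ p
  ... | inj₁ 0≤p = ℚ.≤-reflexive (sym (ℚ.0≤p⇒∣p∣≡p 0≤p))
  ... | inj₂ p≤0 = ℚ.≤-trans p≤0 (ℚ.0≤∣p∣ p)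

  ∣p-q∣≡∣q-p∣ : ∀ p q → ℚ.∣ p ℚ.- q ∣ ≡ ℚ.∣ q ℚ.- p ∣
  ∣p-q∣≡∣q-p∣ p q = trans (cong ℚ.∣_∣ (solve 2 (λ p q → p :- q := :- (q :- p)) refl p q))
                         (ℚ.∣-p∣≡∣p∣ (q ℚ.- p))

  ∣p∣≤∣p-q∣+∣q∣ : ∀ p q → ℚ.∣ p ∣ ℚ.≤ ℚ.∣ p ℚ.- q ∣ ℚ.+ ℚ.∣ q ∣
  ∣p∣≤∣p-q∣+∣q∣ p q = subst (λ r → ℚ.∣ r ∣ ℚ.≤ ℚ.∣ p ℚ.- q ∣ ℚ.+ ℚ.∣ q ∣)
    (solve 2 (λ p q → (p :- q) :+ q := p) refl p q) (ℚ.∣p+q∣≤∣p∣+∣q∣ (p ℚ.- q) q)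

  ∣p∣-∣q∣≤∣p-q∣ : ∀ p q → ℚ.∣ p ∣ ℚ.- ℚ.∣ q ∣ ℚ.≤ ℚ.∣ p ℚ.- q ∣
  ∣p∣-∣q∣≤∣p-q∣ p q = subst (ℚ.∣ p ∣ ℚ.- ℚ.∣ q ∣ ℚ.≤_)
    (solve 2 (λ d q → (d :+ q) :- q := d) refl ℚ.∣ p ℚ.- q ∣ ℚ.∣ q ∣)
    (ℚ.+-monoˡ-≤ (ℚ.- ℚ.∣ q ∣) (∣p∣≤∣p-q∣+∣q∣ p q))

  ∣∣p∣-∣q∣∣≤∣p-q∣ : ∀ p q → ℚ.∣ ℚ.∣ p ∣ ℚ.- ℚ.∣ q ∣ ∣ ℚ.≤ ℚ.∣ p ℚ.- q ∣
  ∣∣p∣-∣q∣∣≤∣p-q∣ p q with ℚ.∣p∣≡p∨∣p∣≡-p (ℚ.∣ p ∣ ℚ.- ℚ.∣ q ∣)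
  ... | inj₁ eq rewrite eq = ∣p∣-∣q∣≤∣p-q∣ p q
  ... | inj₂ eq rewrite eq =
    subst₂ ℚ._≤_ (solve 2 (λ a b → b :- a := :- (a :- b)) refl ℚ.∣ p ∣ ℚ.∣ q ∣)
                 (∣p-q∣≡∣q-p∣ q p) (∣p∣-∣q∣≤∣p-q∣ q p)

  eventualBound : ∀ x → IsCauchy x →
                  ∃ λ B → (0ℚ ℚ.< B) × (∃ λ N → ∀ n → n ≥ N → ℚ.∣ x n ∣ ℚ.≤ B)
  eventualBound x c with N , close ← c 1ℚ (ℚ.positive⁻¹ 1ℚ) =
    1ℚ ℚ.+ ℚ.∣ x N ∣ , ℚ.+-mono-<-≤ (ℚ.positive⁻¹ 1ℚ) (ℚ.0≤∣p∣ (x N)) , N , λ n n≥N →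
      ℚ.≤-trans (∣p∣≤∣p-q∣+∣q∣ (x n) (x N))
                (ℚ.+-monoˡ-≤ ℚ.∣ x N ∣ (ℚ.<⇒≤ (close n N n≥N ℕ.≤-refl)))

open Bounds

const-cauchy : ∀ p → IsCauchy (λ _ → p)
const-cauchy p ε ε>0 = 0 , λ _ _ _ _ → subst (ℚ._< ε) (cong ℚ.∣_∣ (sym (ℚ.+-inverseʳ p))) ε>0

minus-cauchy : ∀ x y → IsCauchy x → IsCauchy y → IsCauchy (λ n → x n ℚ.- y n)
minus-cauchy x y cx cy ε ε>0
  with M , hx ← cx (ε ℚ.* ℚ.½) (half ε ε>0)
     | N , hy ← cy (ε ℚ.* ℚ.½) (half ε ε>0) = M ℕ.⊔ N , λ m n m≥ n≥ → begin-strict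
  ℚ.∣ (x m ℚ.- y m) ℚ.- (x n ℚ.- y n) ∣
    ≡⟨ cong ℚ.∣_∣ (solve 4 (λ a b c d → (a :- b) :- (c :- d) := (a :- c) :- (b :- d))
                         refl (x m) (y m) (x n) (y n)) ⟩
  ℚ.∣ (x m ℚ.- x n) ℚ.- (y m ℚ.- y n) ∣
    ≤⟨ ℚ.∣p-q∣≤∣p∣+∣q∣ (x m ℚ.- x n) (y m ℚ.- y n) ⟩
  ℚ.∣ x m ℚ.- x n ∣ ℚ.+ ℚ.∣ y m ℚ.- y n ∣
    <⟨ ℚ.+-mono-< (hx m n (ℕ.m⊔n≤o⇒m≤o M N m≥) (ℕ.m⊔n≤o⇒m≤o M N n≥))
                  (hy m n (ℕ.m⊔n≤o⇒n≤o M N m≥) (ℕ.m⊔n≤o⇒n≤o M N n≥)) ⟩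
  ε ℚ.* ℚ.½ ℚ.+ ε ℚ.* ℚ.½
    ≡⟨ half+half ε ⟩
  ε ∎
  where open ℚ.≤-Reasoning

module Products where
  product-close : ∀ {A B δ} a b c d → 0ℚ ℚ.< A → 0ℚ ℚ.< B →
                  ℚ.∣ a ∣ ℚ.≤ A → ℚ.∣ d ∣ ℚ.≤ B →
                  ℚ.∣ a ℚ.- c ∣ ℚ.< δ → ℚ.∣ b ℚ.- d ∣ ℚ.< δ →
                  ℚ.∣ a ℚ.* b ℚ.- c ℚ.* d ∣ ℚ.< A ℚ.* δ ℚ.+ δ ℚ.* B
  product-close {A} {B} {δ} a b c d 0<A 0<B a≤A d≤B a-c<δ b-d<δ = begin-strict
    ℚ.∣ a ℚ.* b ℚ.- c ℚ.* d ∣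
      ≡⟨ cong ℚ.∣_∣ (solve 4 (λ a b c d → a :* b :- c :* d := a :* (b :- d) :+ (a :- c) :* d)
                           refl a b c d) ⟩
    ℚ.∣ a ℚ.* (b ℚ.- d) ℚ.+ (a ℚ.- c) ℚ.* d ∣
      ≤⟨ ℚ.∣p+q∣≤∣p∣+∣q∣ (a ℚ.* (b ℚ.- d)) ((a ℚ.- c) ℚ.* d) ⟩
    ℚ.∣ a ℚ.* (b ℚ.- d) ∣ ℚ.+ ℚ.∣ (a ℚ.- c) ℚ.* d ∣
      ≡⟨ cong₂ ℚ._+_ (ℚ.∣p*q∣≡∣p∣*∣q∣ a (b ℚ.- d)) (ℚ.∣p*q∣≡∣p∣*∣q∣ (a ℚ.- c) d) ⟩
    ℚ.∣ a ∣ ℚ.* ℚ.∣ b ℚ.- d ∣ ℚ.+ ℚ.∣ a ℚ.- c ∣ ℚ.* ℚ.∣ d ∣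
      ≤⟨ ℚ.+-mono-≤
           (ℚ.*-monoʳ-≤-nonNeg ℚ.∣ b ℚ.- d ∣ {{ℚ.∣-∣-nonNeg (b ℚ.- d)}} a≤A)
           (ℚ.*-monoˡ-≤-nonNeg ℚ.∣ a ℚ.- c ∣ {{ℚ.∣-∣-nonNeg (a ℚ.- c)}} d≤B) ⟩
    A ℚ.* ℚ.∣ b ℚ.- d ∣ ℚ.+ ℚ.∣ a ℚ.- c ∣ ℚ.* B
      <⟨ ℚ.+-mono-< (ℚ.*-monoʳ-<-pos A {{ℚ.positive 0<A}} b-d<δ)
                    (ℚ.*-monoˡ-<-pos B {{ℚ.positive 0<B}} a-c<δ) ⟩
    A ℚ.* δ ℚ.+ δ ℚ.* B ∎
    where open ℚ.≤-Reasoning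

  inverse : ∀ C → 0ℚ ℚ.< C → ∃ λ i → (0ℚ ℚ.< i) × i ℚ.* C ≡ 1ℚ
  inverse C 0<C =
    ℚ.1/ C , ℚ.positive⁻¹ (ℚ.1/ C) {{ℚ.1/pos⇒pos C}} , ℚ.*-inverseˡ C
    where
    instance
      C-pos : ℚ.Positive C
      C-pos = ℚ.positive 0<C
      C≢0 : ℚ.NonZero C
      C≢0 = ℚ.pos⇒nonZero C

  share : ∀ A B ε → 0ℚ ℚ.< A → 0ℚ ℚ.< B → ε ℚ.> 0ℚ →
          ∃ λ δ → (δ ℚ.> 0ℚ) × A ℚ.* δ ℚ.+ δ ℚ.* B ≡ ε
  share A B ε 0<A 0<B ε>0 with i , 0<i , iC≡1 ← inverse (A ℚ.+ B) (ℚ.+-mono-< 0<A 0<B) =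
      ε ℚ.* i
    , subst (ℚ._< ε ℚ.* i) (ℚ.*-zeroˡ i) (ℚ.*-monoˡ-<-pos i {{ℚ.positive 0<i}} ε>0)
    , trans (solve 4 (λ a b e i → a :* (e :* i) :+ (e :* i) :* b := e :* (i :* (a :+ b)))
                   refl A B ε i)
            (trans (cong (ε ℚ.*_) iC≡1) (ℚ.*-identityʳ ε))

open Products

times-cauchy : ∀ x y → IsCauchy x → IsCauchy y → IsCauchy (λ n → x n ℚ.* y n)
times-cauchy x y cx cy ε ε>0 =
  let A , 0<A , M₁ , x≤A = eventualBound x cx
      B , 0<B , N₁ , y≤B = eventualBound y cy
      δ , δ>0 , Aδ+δB≡ε  = share A B ε 0<A 0<B ε>0
      M₂ , hx            = cx δ δ>0
      N₂ , hy            = cy δ δ>0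
      K₁ = M₁ ℕ.⊔ N₁
      K₂ = M₂ ℕ.⊔ N₂
  in K₁ ℕ.⊔ K₂ , λ m n m≥ n≥ →
  let m≥K₁ = ℕ.m⊔n≤o⇒m≤o K₁ K₂ m≥
      m≥K₂ = ℕ.m⊔n≤o⇒n≤o K₁ K₂ m≥
      n≥K₁ = ℕ.m⊔n≤o⇒m≤o K₁ K₂ n≥
      n≥K₂ = ℕ.m⊔n≤o⇒n≤o K₁ K₂ n≥
  in subst (ℚ.∣ x m ℚ.* y m ℚ.- x n ℚ.* y n ∣ ℚ.<_) Aδ+δB≡ε
    (product-close (x m) (y m) (x n) (y n) 0<A 0<B
      (x≤A m (ℕ.m⊔n≤o⇒m≤o M₁ N₁ m≥K₁)) (y≤B n (ℕ.m⊔n≤o⇒n≤o M₁ N₁ n≥K₁))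
      (hx m n (ℕ.m⊔n≤o⇒m≤o M₂ N₂ m≥K₂) (ℕ.m⊔n≤o⇒m≤o M₂ N₂ n≥K₂))
      (hy m n (ℕ.m⊔n≤o⇒n≤o M₂ N₂ m≥K₂) (ℕ.m⊔n≤o⇒n≤o M₂ N₂ n≥K₂)))

abs-cauchy : ∀ x → IsCauchy x → IsCauchy (λ n → ℚ.∣ x n ∣)
abs-cauchy x c ε ε>0 with N , h ← c ε ε>0 = N , λ m n m≥ n≥ →
  ℚ.≤-<-trans (∣∣p∣-∣q∣∣≤∣p-q∣ (x m) (x n)) (h m n m≥ n≥)

fromℚ : ℚ → ℝ
fromℚ p = real (λ _ → p) (const-cauchy p)

infixl 6 _-_
infixl 7 _*_
infix  4 _≤_ _⟶_

_-_ : ℝ → ℝ → ℝ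
x - y = real (λ n → approx x n ℚ.- approx y n) (minus-cauchy (approx x) (approx y) (cauchy x) (cauchy y))

_*_ : ℝ → ℝ → ℝ
x * y = real (λ n → approx x n ℚ.* approx y n) (times-cauchy (approx x) (approx y) (cauchy x) (cauchy y))

∣_∣ : ℝ → ℝ
∣ x ∣ = real (λ n → ℚ.∣ approx x n ∣) (abs-cauchy (approx x) (cauchy x))

_≤_ : ℝ → ℝ → Set
x ≤ y = ∀ δ → δ ℚ.> 0ℚ → ∃ λ N → ∀ n → n ≥ N → approx x n ℚ.≤ approx y n ℚ.+ δ

_⟶_ : (ℕ → ℝ) → ℝ → Set
a ⟶ x = ∀ ε → ε ℚ.> 0ℚ → ∃ λ N → ∀ n → n ≥ N → ∣ a n - x ∣ ≤ fromℚ ε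

------------------------------------------------------------------------
-- π

leibnizTerm : ℕ → ℚ
leibnizTerm k = (-1ℤ ℤ.^ k) / suc (2 ℕ.* k)

leibnizSum : ℕ → ℚ
leibnizSum zero    = 0ℚ
leibnizSum (suc n) = leibnizSum n ℚ.+ leibnizTerm n

module Leibniz where
  a : ℕ → ℚ
  a k = + 1 / suc (2 ℕ.* k)

  sgn : ℕ → ℚ
  sgn k = (-1ℤ ℤ.^ k) / 1

  tail : ℕ → ℕ → ℚ
  tail n zero    = 0ℚ
  tail n (suc m) = a n ℚ.- tail (suc n) m

  /-homo-* : ∀ i d .{{_ : ℕ.NonZero d}} → i / d ≡ (i / 1) ℚ.* (+ 1 / d)
  /-homo-* i d@(suc d-1) = ℚ.toℚᵘ-injective (begin-equality
    ℚ.toℚᵘ (i / d)                              ≃⟨ ℚ.toℚᵘ-fromℚᵘ (ℚᵘ.mkℚᵘ i d-1) ⟩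
    ℚᵘ.mkℚᵘ i d-1                               ≃⟨ ℚᵘ.*≡* (cong₂ ℤ._*_ (sym (ℤ.*-identityʳ i)) (cong (λ k → + suc k) (ℕ.+-identityʳ d-1))) ⟩
    ℚᵘ.mkℚᵘ i 0 ℚᵘ.* ℚᵘ.mkℚᵘ (+ 1) d-1          ≃⟨ ℚᵘ.*-cong (ℚ.toℚᵘ-fromℚᵘ (ℚᵘ.mkℚᵘ i 0)) (ℚ.toℚᵘ-fromℚᵘ (ℚᵘ.mkℚᵘ (+ 1) d-1)) ⟨
    ℚ.toℚᵘ (i / 1) ℚᵘ.* ℚ.toℚᵘ (+ 1 / d)        ≃⟨ ℚ.toℚᵘ-homo-* (i / 1) (+ 1 / d) ⟨
    ℚ.toℚᵘ ((i / 1) ℚ.* (+ 1 / d))              ∎)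
    where open ℚᵘ.≤-Reasoning

  neg-/1 : ∀ i → (-1ℤ ℤ.* i) / 1 ≡ ℚ.- (i / 1)
  neg-/1 i = trans (cong (_/ 1) (ℤ.-1*i≡-i i)) (lemma i)
    where
    lemma : ∀ i → (ℤ.- i) / 1 ≡ ℚ.- (i / 1)
    lemma (+ zero)      = refl
    lemma ℤ.+[1+ n ]    = refl
    lemma ℤ.-[1+ n ]    = solve 1 (λ x → x := :- (:- x)) refl (+ suc n / 1)

  sgn-suc : ∀ n → sgn (suc n) ≡ ℚ.- sgn n
  sgn-suc n = neg-/1 (-1ℤ ℤ.^ n)

  ∣sgn∣ : ∀ n → ℚ.∣ sgn n ∣ ≡ 1ℚ
  ∣sgn∣ zero    = refl
  ∣sgn∣ (suc n) = trans (cong ℚ.∣_∣ (sgn-suc n)) (trans (ℚ.∣-p∣≡∣p∣ (sgn n)) (∣sgn∣ n))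

  sum-split : ∀ n m → leibnizSum (m ℕ.+ n) ≡ leibnizSum n ℚ.+ sgn n ℚ.* tail n m
  sum-split n zero    = solve 2 (λ s g → s := s :+ g :* con 0ℚ) refl (leibnizSum n) (sgn n)
  sum-split n (suc m) = begin
    leibnizSum (suc m ℕ.+ n)
      ≡⟨ cong leibnizSum (sym (ℕ.+-suc m n)) ⟩
    leibnizSum (m ℕ.+ suc n)
      ≡⟨ sum-split (suc n) m ⟩
    (leibnizSum n ℚ.+ leibnizTerm n) ℚ.+ sgn (suc n) ℚ.* tail (suc n) m
      ≡⟨ cong₂ (λ t s → (leibnizSum n ℚ.+ t) ℚ.+ s ℚ.* tail (suc n) m)
               (/-homo-* (-1ℤ ℤ.^ n) (suc (2 ℕ.* n))) (sgn-suc n) ⟩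
    (leibnizSum n ℚ.+ sgn n ℚ.* a n) ℚ.+ ℚ.- sgn n ℚ.* tail (suc n) m
      ≡⟨ solve 4 (λ s g a t → (s :+ g :* a) :+ :- g :* t := s :+ g :* (a :- t))
               refl (leibnizSum n) (sgn n) (a n) (tail (suc n) m) ⟩
    leibnizSum n ℚ.+ sgn n ℚ.* tail n (suc m) ∎
    where open ≡-Reasoning

  1/-antimono : ∀ j k → j ℕ.≤ k → + 1 / suc k ℚ.≤ + 1 / suc j
  1/-antimono j k j≤k = ℚ.toℚᵘ-cancel-≤ (begin
    ℚ.toℚᵘ (+ 1 / suc k)  ≃⟨ ℚ.toℚᵘ-fromℚᵘ (ℚᵘ.mkℚᵘ (+ 1) k) ⟩
    ℚᵘ.mkℚᵘ (+ 1) k       ≤⟨ ℚᵘ.*≤* (ℤ.*-monoˡ-≤-nonNeg (+ 1) (ℤ.+≤+ (ℕ.s≤s j≤k))) ⟩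
    ℚᵘ.mkℚᵘ (+ 1) j       ≃⟨ ℚ.toℚᵘ-fromℚᵘ (ℚᵘ.mkℚᵘ (+ 1) j) ⟨
    ℚ.toℚᵘ (+ 1 / suc j)  ∎)
    where open ℚᵘ.≤-Reasoning

  a≥0 : ∀ n → 0ℚ ℚ.≤ a n
  a≥0 n = ℚ.nonNegative⁻¹ (a n) {{ℚ.normalize-nonNeg 1 (suc (2 ℕ.* n))}}

  a-decreasing : ∀ n → a (suc n) ℚ.≤ a n
  a-decreasing n = 1/-antimono (2 ℕ.* n) (2 ℕ.* suc n) (ℕ.*-monoʳ-≤ 2 (ℕ.n≤1+n n))

  tail-bounds : ∀ n m → (0ℚ ℚ.≤ tail n m) × (tail n m ℚ.≤ a n)
  tail-bounds n zero = ℚ.≤-refl , a≥0 n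
  tail-bounds n (suc m) with lo , hi ← tail-bounds (suc n) m =
      subst (ℚ._≤ tail n (suc m)) (ℚ.+-inverseʳ (tail (suc n) m))
            (ℚ.+-monoˡ-≤ (ℚ.- tail (suc n) m) (ℚ.≤-trans hi (a-decreasing n)))
    , subst (tail n (suc m) ℚ.≤_) (ℚ.+-identityʳ (a n))
            (ℚ.+-monoʳ-≤ (a n) (ℚ.neg-antimono-≤ lo))

  sum-close : ∀ n m → m ≥ n → ℚ.∣ leibnizSum m ℚ.- leibnizSum n ∣ ℚ.≤ a n
  sum-close n m m≥n = begin
    ℚ.∣ leibnizSum m ℚ.- leibnizSum n ∣
      ≡⟨ cong (λ k → ℚ.∣ leibnizSum k ℚ.- leibnizSum n ∣) (sym (ℕ.m∸n+n≡m m≥n)) ⟩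
    ℚ.∣ leibnizSum (m ℕ.∸ n ℕ.+ n) ℚ.- leibnizSum n ∣
      ≡⟨ cong (λ s → ℚ.∣ s ℚ.- leibnizSum n ∣) (sum-split n (m ℕ.∸ n)) ⟩
    ℚ.∣ leibnizSum n ℚ.+ sgn n ℚ.* t ℚ.- leibnizSum n ∣
      ≡⟨ cong ℚ.∣_∣ (solve 2 (λ s u → (s :+ u) :- s := u) refl (leibnizSum n) (sgn n ℚ.* t)) ⟩
    ℚ.∣ sgn n ℚ.* t ∣
      ≡⟨ ℚ.∣p*q∣≡∣p∣*∣q∣ (sgn n) t ⟩
    ℚ.∣ sgn n ∣ ℚ.* ℚ.∣ t ∣
      ≡⟨ cong₂ ℚ._*_ (∣sgn∣ n) (ℚ.0≤p⇒∣p∣≡p (proj₁ (tail-bounds n (m ℕ.∸ n)))) ⟩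
    1ℚ ℚ.* t
      ≡⟨ ℚ.*-identityˡ t ⟩
    t
      ≤⟨ proj₂ (tail-bounds n (m ℕ.∸ n)) ⟩
    a n ∎
    where
    open ℚ.≤-Reasoning
    t = tail n (m ℕ.∸ n)

  a-small : ∀ ε → ε ℚ.> 0ℚ → ∃ λ n → a n ℚ.< ε
  a-small ε@(ℚ.mkℚ ℤ.+[1+ p ] q-1 _) _ = suc q-1 , ℚ.toℚᵘ-cancel-< (begin-strict
    ℚ.toℚᵘ (a (suc q-1))             ≃⟨ ℚ.toℚᵘ-fromℚᵘ (ℚᵘ.mkℚᵘ (+ 1) (2 ℕ.* suc q-1)) ⟩
    ℚᵘ.mkℚᵘ (+ 1) (2 ℕ.* suc q-1)    <⟨ ℚᵘ.*<* (ℤ.+<+ (ℕ.s≤s le)) ⟩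
    ℚᵘ.mkℚᵘ ℤ.+[1+ p ] q-1           ∎)
    where
    open ℚᵘ.≤-Reasoning
    le : suc (q-1 ℕ.+ 0) ℕ.≤ 2 ℕ.* suc q-1 ℕ.+ p ℕ.* suc (2 ℕ.* suc q-1)
    le = ℕ.≤-trans (ℕ.*-monoˡ-≤ (suc q-1) {1} {2} (ℕ.s≤s ℕ.z≤n)) (ℕ.m≤m+n _ _)
  a-small (ℚ.mkℚ (+ zero) _ _) (ℚ.*<* (ℤ.+<+ ()))
  a-small (ℚ.mkℚ ℤ.-[1+ _ ] _ _) (ℚ.*<* ())

open Leibniz using (a-small; sum-close)

leibnizSum-cauchy : IsCauchy leibnizSum
leibnizSum-cauchy ε ε>0 with N , aN<ε/2 ← a-small (ε ℚ.* ℚ.½) (half ε ε>0) =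
  N , λ m n m≥ n≥ → begin-strict
  ℚ.∣ leibnizSum m ℚ.- leibnizSum n ∣
    ≡⟨ cong ℚ.∣_∣ (solve 3 (λ x y z → x :- y := (x :- z) :- (y :- z))
                         refl (leibnizSum m) (leibnizSum n) (leibnizSum N)) ⟩
  ℚ.∣ (leibnizSum m ℚ.- leibnizSum N) ℚ.- (leibnizSum n ℚ.- leibnizSum N) ∣
    ≤⟨ ℚ.∣p-q∣≤∣p∣+∣q∣ (leibnizSum m ℚ.- leibnizSum N) (leibnizSum n ℚ.- leibnizSum N) ⟩
  ℚ.∣ leibnizSum m ℚ.- leibnizSum N ∣ ℚ.+ ℚ.∣ leibnizSum n ℚ.- leibnizSum N ∣
    <⟨ ℚ.+-mono-< (ℚ.≤-<-trans (sum-close N m m≥) aN<ε/2) (ℚ.≤-<-trans (sum-close N n n≥) aN<ε/2) ⟩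
  ε ℚ.* ℚ.½ ℚ.+ ε ℚ.* ℚ.½
    ≡⟨ half+half ε ⟩
  ε ∎
  where open ℚ.≤-Reasoning

-- π is defined by the Gregory–Leibniz series, π / 4 = 1 - 1/3 + 1/5 - ⋯.
π : ℝ
π = fromℚ (+ 4 / 1) * real leibnizSum leibnizSum-cauchy

{-# OPTIONS --safe #-}

-- Attaching a vertex to the ends of an edge raises the degree and the number of edges
-- among the neighbours of either end by one, so E = d - 1 throughout and the local
-- clustering coefficient of a vertex of degree d is 2 / d.  The expected number of
-- vertices of degree d after t steps is p_d (t + ½) + O(1) uniformly in d, where
-- p_d = 12 / (d (d + 1) (d + 2)), because the deviation from p_d (t + ½) is transported
-- by subconvex combinations.  Hence the limit is ∑ 24 / (d² (d + 1) (d + 2)) over d ≥ 2,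
-- which is 12 ∑ 1 / k² - 19 by partial fractions.  Since π is given by the
-- Gregory–Leibniz series, ∑ 1 / k² = π² / 6 is obtained by squaring that series: the
-- off-diagonal terms combine into alternating harmonic segments of total size O(log N / N).
module Submission where

open import Data.Empty using (⊥; ⊥-elim)
open import Data.Fin as Fin using (Fin; fromℕ; inject₁)
import Data.Fin.Properties as Fin
open import Data.Integer as ℤ using (+_; -1ℤ)
import Data.Integer.Properties as ℤ
open import Data.List as List using (List; []; _∷_; allFin; tabulate; filter; length; map; _++_)
open import Data.List.Membership.Propositional using (_∈_)
open import Data.List.Membership.Propositional.Properties using (∈-allFin)
open import Data.List.NonEmpty as List⁺ using (List⁺; toList)
import Data.List.Properties as List
open import Data.List.Relation.Unary.All as All using (All; []; _∷_)
import Data.List.Relation.Unary.All.Properties as All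
open import Data.List.Relation.Unary.AllPairs using ([]; _∷_)
open import Data.List.Relation.Unary.Any as Any using (Any; here; there)
import Data.List.Relation.Unary.Any.Properties as Any
open import Data.List.Relation.Unary.Unique.Propositional using (Unique)
import Data.List.Relation.Unary.Unique.Propositional.Properties as Unique
open import Data.Nat as ℕ using (ℕ; zero; suc)
import Data.Nat.Properties as ℕ
open import Data.Product using (_×_; _,_; ∃; proj₁; proj₂)
import Data.Rational as ℚ
import Data.Rational.Properties as ℚ
open import Data.Rational.Solver using (module +-*-Solver)
import Data.Rational.Unnormalised as ℚᵘ
import Data.Rational.Unnormalised.Properties as ℚᵘ
open import Data.Sum using (_⊎_; inj₁; inj₂; [_,_]′)
open import Data.Unit using (tt)
open import Function using (_∘_; id)
open import Relation.Binary.PropositionalEquality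
open import Relation.Nullary using (Dec; yes; no; ¬_)
open import Relation.Nullary.Decidable using (_×-dec_; _⊎-dec_)
open import Relation.Unary using (Decidable)

-- The only statistics of the random graph that are followed are sums over the vertices of a
-- function g of the degree. One step turns the expected sum for g into the sum for another function
-- of the degree plus a constant, because a vertex of degree d lies on d of the 2 t + 1 edges; hence
-- the expected degree counts obey a closed linear recursion. The obstacle to transporting the
-- deviations is the coefficient 1 - d / (2 t + 1), which is negative for large d. There the support
-- helps: after t steps no degree exceeds t + 1, which is below 2 t once t ≥ 2, so in the bad range
-- only p_d (t + ½) is left to bound. An error that is O(1) in each degree suffices, since the
-- weights 2 / d add up to a logarithm while the average divides by t + 2. The expectation at time t
-- is compared with the expression in the t-th Leibniz sum, at the same index t. All estimates thus
-- concern sequences of rationals, and the passage to real numbers happens once, at the end.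

-- Rational arithmetic, finite sums and null sequences

module Rationals where

  open import Data.Rational
  open import Data.Rational.Properties
  open +-*-Solver using (solve; _:+_; _:*_; _:-_; :-_; _:=_; con)
  open import Defs using (module Bounds; module Leibniz)

  opaque
    -- `inv n` is 1/(n + 1), so it is defined at every index. Both functions are opaque: outside the
    -- opaque blocks they are atoms for the ring solver, known only through lemmas such as `q-suc`
    -- and `inv-eq`.
    q : ℕ → ℚ
    q n = + n / 1

    inv : ℕ → ℚ
    inv n = + 1 / suc n

    q-suc : ∀ n → q (suc n) ≡ 1ℚ + q n
    q-suc n = toℚᵘ-injective (begin-equality
      toℚᵘ (q (suc n))                     ≃⟨ toℚᵘ-fromℚᵘ (ℚᵘ.mkℚᵘ (+ suc n) 0) ⟩
      ℚᵘ.mkℚᵘ (+ suc n) 0                  ≃⟨ ℚᵘ.*≡* (cong (λ i → (+ 1 ℤ.+ i) ℤ.* + 1) (sym (ℤ.*-identityʳ (+ n)))) ⟩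
      ℚᵘ.1ℚᵘ ℚᵘ.+ ℚᵘ.mkℚᵘ (+ n) 0          ≃⟨ ℚᵘ.+-congʳ ℚᵘ.1ℚᵘ (toℚᵘ-fromℚᵘ (ℚᵘ.mkℚᵘ (+ n) 0)) ⟨
      toℚᵘ 1ℚ ℚᵘ.+ toℚᵘ (q n)              ≃⟨ toℚᵘ-homo-+ 1ℚ (q n) ⟨
      toℚᵘ (1ℚ + q n)                      ∎)
      where open ℚᵘ.≤-Reasoning

    q-zero : q 0 ≡ 0ℚ
    q-zero = refl

    inv-zero : inv 0 ≡ 1ℚ
    inv-zero = refl

    /≡q*inv : ∀ m n → + m / suc n ≡ q m * inv n
    /≡q*inv m n = Leibniz./-homo-* (+ m) (suc n)

    /1≡q : ∀ m → + m / 1 ≡ q m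
    /1≡q m = refl

    1/≡inv : ∀ n → + 1 / suc n ≡ inv n
    1/≡inv n = refl

  q-+ : ∀ m n → q (m ℕ.+ n) ≡ q m + q n
  q-+ zero    n = sym (trans (cong (_+ q n) q-zero) (+-identityˡ (q n)))
  q-+ (suc m) n = begin
    q (suc (m ℕ.+ n))   ≡⟨ q-suc (m ℕ.+ n) ⟩
    1ℚ + q (m ℕ.+ n)    ≡⟨ cong (_+_ 1ℚ) (q-+ m n) ⟩
    1ℚ + (q m + q n)    ≡⟨ +-assoc 1ℚ (q m) (q n) ⟨
    1ℚ + q m + q n      ≡⟨ cong (_+ q n) (q-suc m) ⟨
    q (suc m) + q n     ∎
    where open ≡-Reasoning

  q-* : ∀ m n → q (m ℕ.* n) ≡ q m * q n
  q-* zero    n = trans q-zero (sym (trans (cong (_* q n) q-zero) (*-zeroˡ (q n))))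
  q-* (suc m) n = begin
    q (n ℕ.+ m ℕ.* n)   ≡⟨ q-+ n (m ℕ.* n) ⟩
    q n + q (m ℕ.* n)   ≡⟨ cong (_+_ (q n)) (q-* m n) ⟩
    q n + q m * q n     ≡⟨ solve 2 (λ m n → n :+ m :* n := (con 1ℚ :+ m) :* n) refl (q m) (q n) ⟩
    (1ℚ + q m) * q n    ≡⟨ cong (_* q n) (q-suc m) ⟨
    q (suc m) * q n     ∎
    where open ≡-Reasoning

  opaque
    unfolding q inv

    q-mono : ∀ {m n} → m ℕ.≤ n → q m ≤ q n
    q-mono {m} {n} m≤n = toℚᵘ-cancel-≤ (begin
      toℚᵘ (q m)         ≃⟨ toℚᵘ-fromℚᵘ (ℚᵘ.mkℚᵘ (+ m) 0) ⟩
      ℚᵘ.mkℚᵘ (+ m) 0    ≤⟨ ℚᵘ.*≤* (ℤ.*-monoʳ-≤-nonNeg (+ 1) (ℤ.+≤+ m≤n)) ⟩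
      ℚᵘ.mkℚᵘ (+ n) 0    ≃⟨ toℚᵘ-fromℚᵘ (ℚᵘ.mkℚᵘ (+ n) 0) ⟨
      toℚᵘ (q n)         ∎)
      where open ℚᵘ.≤-Reasoning

  0≤q : ∀ n → 0ℚ ≤ q n
  0≤q n = subst (_≤ q n) q-zero (q-mono ℕ.z≤n)

  opaque
    unfolding q inv

    n/n≡1 : ∀ n → + suc n / suc n ≡ 1ℚ
    n/n≡1 n = fromℚᵘ-cong {ℚᵘ.mkℚᵘ (+ suc n) n} {ℚᵘ.1ℚᵘ}
      (ℚᵘ.*≡* (trans (ℤ.*-identityʳ (+ suc n)) (sym (ℤ.*-identityˡ (+ suc n)))))

    inv-cancel : ∀ n → q (suc n) * inv n ≡ 1ℚ
    inv-cancel n = trans (sym (Leibniz./-homo-* (+ suc n) (suc n))) (n/n≡1 n)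

  inv-eq : ∀ n → (1ℚ + q n) * inv n ≡ 1ℚ
  inv-eq n = trans (cong (_* inv n) (sym (q-suc n))) (inv-cancel n)

  opaque
    unfolding q inv

    0<inv : ∀ n → 0ℚ < inv n
    0<inv n = positive⁻¹ (inv n) {{normalize-pos 1 (suc n)}}

  0≤inv : ∀ n → 0ℚ ≤ inv n
  0≤inv n = <⇒≤ (0<inv n)

  opaque
    unfolding q inv

    inv-antimono : ∀ {j k} → j ℕ.≤ k → inv k ≤ inv j
    inv-antimono {j} {k} = Leibniz.1/-antimono j k

  inv≤1 : ∀ n → inv n ≤ 1ℚ
  inv≤1 n = subst (inv n ≤_) inv-zero (inv-antimono {0} {n} ℕ.z≤n)

  -- An identity that holds modulo relations e ≡ 1 is proved by exhibiting the
  -- cofactors c of the relations.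
  mod₁ : ∀ {l r} c e → e ≡ 1ℚ → l - r ≡ c * (e - 1ℚ) → l ≡ r
  mod₁ {l} {r} c e refl eq = begin
    l               ≡⟨ solve 2 (λ l r → l := (l :- r) :+ r) refl l r ⟩
    (l - r) + r     ≡⟨ cong (_+ r) eq ⟩
    c * (1ℚ - 1ℚ) + r ≡⟨ solve 2 (λ c r → c :* (con 1ℚ :- con 1ℚ) :+ r := r) refl c r ⟩
    r               ∎
    where open ≡-Reasoning

  mod₂ : ∀ {l r} c e c′ e′ → e ≡ 1ℚ → e′ ≡ 1ℚ → l - r ≡ c * (e - 1ℚ) + c′ * (e′ - 1ℚ) → l ≡ r
  mod₂ c e c′ e′ p p′ eq = mod₁ c e p (trans eq (trans
    (cong (λ x → c * (e - 1ℚ) + c′ * (x - 1ℚ)) p′)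
    (solve 2 (λ u c → u :+ c :* (con 1ℚ :- con 1ℚ) := u) refl (c * (e - 1ℚ)) c′)))

  mod₃ : ∀ {l r} c e c′ e′ c″ e″ → e ≡ 1ℚ → e′ ≡ 1ℚ → e″ ≡ 1ℚ →
         l - r ≡ c * (e - 1ℚ) + c′ * (e′ - 1ℚ) + c″ * (e″ - 1ℚ) → l ≡ r
  mod₃ c e c′ e′ c″ e″ p p′ p″ eq = mod₂ c e c′ e′ p p′ (trans eq (trans
    (cong (λ x → c * (e - 1ℚ) + c′ * (e′ - 1ℚ) + c″ * (x - 1ℚ)) p″)
    (solve 2 (λ u c → u :+ c :* (con 1ℚ :- con 1ℚ) := u) refl (c * (e - 1ℚ) + c′ * (e′ - 1ℚ)) c″)))

  mod₄ : ∀ {l r} c e c′ e′ c″ e″ c‴ e‴ → e ≡ 1ℚ → e′ ≡ 1ℚ → e″ ≡ 1ℚ → e‴ ≡ 1ℚ →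
         l - r ≡ c * (e - 1ℚ) + c′ * (e′ - 1ℚ) + c″ * (e″ - 1ℚ) + c‴ * (e‴ - 1ℚ) → l ≡ r
  mod₄ c e c′ e′ c″ e″ c‴ e‴ p p′ p″ p‴ eq = mod₃ c e c′ e′ c″ e″ p p′ p″ (trans eq (trans
    (cong (λ x → c * (e - 1ℚ) + c′ * (e′ - 1ℚ) + c″ * (e″ - 1ℚ) + c‴ * (x - 1ℚ)) p‴)
    (solve 2 (λ u c → u :+ c :* (con 1ℚ :- con 1ℚ) := u) refl
           (c * (e - 1ℚ) + c′ * (e′ - 1ℚ) + c″ * (e″ - 1ℚ)) c‴)))

  *-mono-≤ : ∀ {a b c d} → 0ℚ ≤ c → 0ℚ ≤ b → a ≤ b → c ≤ d → a * c ≤ b * d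
  *-mono-≤ {a} {b} {c} {d} 0≤c 0≤b a≤b c≤d = ≤-trans
    (*-monoʳ-≤-nonNeg c {{nonNegative 0≤c}} a≤b)
    (*-monoˡ-≤-nonNeg b {{nonNegative 0≤b}} c≤d)

  *-monoʳ : ∀ {a b} c → 0ℚ ≤ c → a ≤ b → c * a ≤ c * b
  *-monoʳ c 0≤c = *-monoˡ-≤-nonNeg c {{nonNegative 0≤c}}

  0≤* : ∀ {a b} → 0ℚ ≤ a → 0ℚ ≤ b → 0ℚ ≤ a * b
  0≤* {a} {b} 0≤a 0≤b = subst (_≤ a * b) (*-zeroʳ a) (*-monoʳ a 0≤a 0≤b)

  0≤+ : ∀ {a b} → 0ℚ ≤ a → 0ℚ ≤ b → 0ℚ ≤ a + b
  0≤+ = +-mono-≤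

  0≤- : ∀ {a b} → a ≤ b → 0ℚ ≤ b - a
  0≤- {a} {b} a≤b = subst (_≤ b - a) (+-inverseʳ a) (+-monoˡ-≤ (- a) a≤b)

  p-q≤p : ∀ {p q} → 0ℚ ≤ q → p - q ≤ p
  p-q≤p {p} {q} 0≤q = subst (p - q ≤_) (+-identityʳ p) (+-monoʳ-≤ p (neg-antimono-≤ 0≤q))

  q*inv≤1 : ∀ {m n} → m ℕ.≤ suc n → q m * inv n ≤ 1ℚ
  q*inv≤1 {m} {n} m≤ = subst (q m * inv n ≤_) (inv-cancel n)
    (*-monoʳ-≤-nonNeg (inv n) {{nonNegative (0≤inv n)}} (q-mono m≤))

  S : (ℕ → ℚ) → ℕ → ℚ
  S f zero    = 0ℚ
  S f (suc n) = S f n + f n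

  S-cong : ∀ {f g} n → (∀ k → k ℕ.< n → f k ≡ g k) → S f n ≡ S g n
  S-cong zero    h = refl
  S-cong (suc n) h = cong₂ _+_ (S-cong n (λ k k<n → h k (ℕ.m<n⇒m<1+n k<n))) (h n ℕ.≤-refl)

  S-mono : ∀ {f g} n → (∀ k → k ℕ.< n → f k ≤ g k) → S f n ≤ S g n
  S-mono zero    h = ≤-refl
  S-mono (suc n) h = +-mono-≤ (S-mono n (λ k k<n → h k (ℕ.m<n⇒m<1+n k<n))) (h n ℕ.≤-refl)

  S-+ : ∀ f g n → S (λ k → f k + g k) n ≡ S f n + S g n
  S-+ f g zero    = refl
  S-+ f g (suc n) = trans (cong (_+ (f n + g n)) (S-+ f g n))
    (solve 4 (λ a b c d → (a :+ b) :+ (c :+ d) := (a :+ c) :+ (b :+ d)) refl (S f n) (S g n) (f n) (g n))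

  S-* : ∀ c f n → S (λ k → c * f k) n ≡ c * S f n
  S-* c f zero    = sym (*-zeroʳ c)
  S-* c f (suc n) = trans (cong (_+ c * f n) (S-* c f n)) (sym (*-distribˡ-+ c (S f n) (f n)))

  S-minus : ∀ f g n → S (λ k → f k - g k) n ≡ S f n - S g n
  S-minus f g zero    = refl
  S-minus f g (suc n) = trans (cong (_+ (f n - g n)) (S-minus f g n))
    (solve 4 (λ a b c d → (a :- b) :+ (c :- d) := (a :+ c) :- (b :+ d)) refl (S f n) (S g n) (f n) (g n))

  S-∣∣ : ∀ f n → ∣ S f n ∣ ≤ S (∣_∣ ∘ f) n
  S-∣∣ f zero    = ≤-refl
  S-∣∣ f (suc n) = ≤-trans (∣p+q∣≤∣p∣+∣q∣ (S f n) (f n)) (+-monoˡ-≤ ∣ f n ∣ (S-∣∣ f n))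

  S-suc : ∀ f n → S f (suc n) ≡ f 0 + S (f ∘ suc) n
  S-suc f zero    = trans (+-identityˡ (f 0)) (sym (+-identityʳ (f 0)))
  S-suc f (suc n) = trans (cong (_+ f (suc n)) (S-suc f n)) (+-assoc (f 0) (S (f ∘ suc) n) (f (suc n)))

  S-append : ∀ f m n → S f (n ℕ.+ m) ≡ S f m + S (λ k → f (k ℕ.+ m)) n
  S-append f m zero    = sym (+-identityʳ (S f m))
  S-append f m (suc n) = trans (cong (_+ f (n ℕ.+ m)) (S-append f m n)) (+-assoc (S f m) _ _)

  S-reverse : ∀ f n → S (λ k → f (n ℕ.∸ suc k)) n ≡ S f n
  S-reverse f zero    = refl
  S-reverse f (suc n) = begin
    S (λ k → f (n ℕ.∸ k)) (suc n)             ≡⟨ S-suc (λ k → f (n ℕ.∸ k)) n ⟩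
    f n + S (λ k → f (n ℕ.∸ suc k)) n         ≡⟨ cong (_+_ (f n)) (S-reverse f n) ⟩
    f n + S f n                               ≡⟨ +-comm (f n) (S f n) ⟩
    S f n + f n                               ∎
    where open ≡-Reasoning

  S-const-≤ : ∀ {f} c n → (∀ k → k ℕ.< n → f k ≤ c) → S f n ≤ q n * c
  S-const-≤ c zero    h = ≤-reflexive (sym (trans (cong (_* c) q-zero) (*-zeroˡ c)))
  S-const-≤ {f} c (suc n) h = begin
    S f n + f n       ≤⟨ +-mono-≤ (S-const-≤ c n (λ k k<n → h k (ℕ.m<n⇒m<1+n k<n))) (h n ℕ.≤-refl) ⟩
    q n * c + c       ≡⟨ solve 2 (λ n c → n :* c :+ c := (con 1ℚ :+ n) :* c) refl (q n) c ⟩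
    (1ℚ + q n) * c    ≡⟨ cong (_* c) (q-suc n) ⟨
    q (suc n) * c     ∎
    where open ≤-Reasoning

  Null : (ℕ → ℚ) → Set
  Null x = ∀ ε → ε > 0ℚ → ∃ λ N → ∀ n → n ℕ.≥ N → ∣ x n ∣ ≤ ε

  Null-+ : ∀ {x y} → Null x → Null y → Null (λ n → x n + y n)
  Null-+ {x} {y} nx ny ε ε>0
    with M , hx ← nx (ε * ½) (Bounds.half ε ε>0)
       | N , hy ← ny (ε * ½) (Bounds.half ε ε>0) = M ℕ.⊔ N , λ n n≥ → begin
    ∣ x n + y n ∣       ≤⟨ ∣p+q∣≤∣p∣+∣q∣ (x n) (y n) ⟩
    ∣ x n ∣ + ∣ y n ∣   ≤⟨ +-mono-≤ (hx n (ℕ.m⊔n≤o⇒m≤o M N n≥)) (hy n (ℕ.m⊔n≤o⇒n≤o M N n≥)) ⟩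
    ε * ½ + ε * ½       ≡⟨ Bounds.half+half ε ⟩
    ε                   ∎
    where open ≤-Reasoning

  Null-≤ : ∀ {x y} → (∀ n → ∣ x n ∣ ≤ y n) → Null y → Null x
  Null-≤ {x} {y} x≤y ny ε ε>0 with N , h ← ny ε ε>0 = N , λ n n≥ →
    ≤-trans (x≤y n) (≤-trans (Bounds.p≤∣p∣ (y n)) (h n n≥))

  Null-cong : ∀ {x y} → (∀ n → x n ≡ y n) → Null x → Null y
  Null-cong eq nx ε ε>0 with N , h ← nx ε ε>0 = N , λ n n≥ → subst (λ z → ∣ z ∣ ≤ ε) (eq n) (h n n≥)

  Null-suc : ∀ {x} → Null x → Null (x ∘ suc)
  Null-suc nx ε ε>0 with N , h ← nx ε ε>0 = N , λ n n≥ → h (suc n) (ℕ.m≤n⇒m≤1+n n≥)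

  Null-q* : ∀ {x} k → Null x → Null (λ n → q k * x n)
  Null-q* {x} zero nx ε ε>0 = 0 , λ n _ → subst (λ z → ∣ z ∣ ≤ ε) (sym (trans (cong (_* x n) q-zero) (*-zeroˡ (x n)))) (<⇒≤ ε>0)
  Null-q* {x} (suc k) nx = Null-cong
    (λ n → trans (solve 2 (λ x k → x :+ k :* x := (con 1ℚ :+ k) :* x) refl (x n) (q k))
                 (cong (_* x n) (sym (q-suc k))))
    (Null-+ nx (Null-q* k nx))

  Null-neg : ∀ {x} → Null x → Null (-_ ∘ x)
  Null-neg {x} nx ε ε>0 with N , h ← nx ε ε>0 = N , λ n n≥ →
    subst (_≤ ε) (sym (∣-p∣≡∣p∣ (x n))) (h n n≥)

  opaque
    unfolding q inv

    Null-inv : Null inv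
    Null-inv ε ε>0 with N , h ← Leibniz.a-small ε ε>0 = 2 ℕ.* N , λ n n≥ → begin
      ∣ inv n ∣     ≡⟨ 0≤p⇒∣p∣≡p (0≤inv n) ⟩
      inv n         ≤⟨ inv-antimono n≥ ⟩
      inv (2 ℕ.* N) ≤⟨ <⇒≤ h ⟩
      ε             ∎
      where open ≤-Reasoning

  -- Harmonic numbers and the vanishing of their averages

  H : ℕ → ℚ
  H = S inv

  -- The first k terms are at most 1 and the later ones at most 1/(k + 1). With k fixed and m
  -- growing, this makes the average of the terms small.
  H-bound : ∀ k m → H (m ℕ.+ k) ≤ q k + q m * inv k
  H-bound k m = begin
    H (m ℕ.+ k)                           ≡⟨ S-append inv k m ⟩
    H k + S (λ j → inv (j ℕ.+ k)) m       ≤⟨ +-mono-≤ (S-const-≤ 1ℚ k (λ j _ → inv≤1 j))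
                                               (S-const-≤ (inv k) m (λ j _ → inv-antimono (ℕ.m≤n+m k j))) ⟩
    q k * 1ℚ + q m * inv k                ≡⟨ cong (_+ q m * inv k) (*-identityʳ (q k)) ⟩
    q k + q m * inv k                     ∎
    where open ≤-Reasoning

  0≤H : ∀ n → 0ℚ ≤ H n
  0≤H zero    = ≤-refl
  0≤H (suc n) = 0≤+ (0≤H n) (0≤inv n)

  Null-H : Null (λ n → inv n * H n)
  Null-H ε ε>0
    -- K comes first and makes every term past K small; N then makes the K initial terms negligible
    -- after division by n + 1.
    with K , hK ← Null-inv (ε * ½) (Bounds.half ε ε>0)
    with N , hN ← Null-q* K Null-inv (ε * ½) (Bounds.half ε ε>0) = K ℕ.⊔ N , λ n n≥ →
    let K≤n = ℕ.m⊔n≤o⇒m≤o K N n≥ ; m = n ℕ.∸ K in begin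
    ∣ inv n * H n ∣                         ≡⟨ 0≤p⇒∣p∣≡p (0≤* (0≤inv n) (0≤H n)) ⟩
    inv n * H n                             ≡⟨ cong (λ k → inv n * H k) (ℕ.m∸n+n≡m K≤n) ⟨
    inv n * H (m ℕ.+ K)                     ≤⟨ *-monoʳ (inv n) (0≤inv n) (H-bound K m) ⟩
    inv n * (q K + q m * inv K)             ≡⟨ solve 4 (λ i k m j → i :* (k :+ m :* j) := k :* i :+ (m :* i) :* j)
                                                     refl (inv n) (q K) (q m) (inv K) ⟩
    q K * inv n + (q m * inv n) * inv K     ≤⟨ +-mono-≤ (≤-trans (Bounds.p≤∣p∣ _) (hN n (ℕ.m⊔n≤o⇒n≤o K N n≥)))
                                                 (*-monoʳ-≤-nonNeg (inv K) {{nonNegative (0≤inv K)}}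
                                                   (q*inv≤1 (ℕ.m≤n⇒m≤1+n (ℕ.m∸n≤m n K)))) ⟩
    ε * ½ + 1ℚ * inv K                      ≤⟨ +-monoʳ-≤ (ε * ½) (≤-trans (≤-reflexive (*-identityˡ (inv K)))
                                                 (≤-trans (Bounds.p≤∣p∣ (inv K)) (hK K ℕ.≤-refl))) ⟩
    ε * ½ + ε * ½                           ≡⟨ Bounds.half+half ε ⟩
    ε                                       ∎
    where open ≤-Reasoning

  -- The denominators m + 1 and n + 1 add up to m + n + 2. Along a sum with m + n constant the first
  -- factor on the right comes out, and a convolution of reciprocals becomes two harmonic sums.
  inv-* : ∀ m n → inv m * inv n ≡ inv (suc m ℕ.+ n) * (inv m + inv n)
  inv-* m n = mod₃ (z * y) ((1ℚ + q m) * x) (z * x) ((1ℚ + q n) * y)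
                   (- (x * y)) ((1ℚ + (1ℚ + q m + q n)) * z)
    (inv-eq m) (inv-eq n)
    (trans (cong (λ k → (1ℚ + k) * z) (trans (cong (_+ q n) (sym (q-suc m))) (sym (q-+ (suc m) n)))) (inv-eq (suc m ℕ.+ n)))
    (solve 5 (λ a b x y z → x :* y :- z :* (x :+ y) :=
       z :* y :* ((con 1ℚ :+ a) :* x :- con 1ℚ) :+ z :* x :* ((con 1ℚ :+ b) :* y :- con 1ℚ)
       :+ (:- (x :* y)) :* ((con 1ℚ :+ (con 1ℚ :+ a :+ b)) :* z :- con 1ℚ)) refl (q m) (q n) x y z)
    where
    x = inv m
    y = inv n
    z = inv (suc m ℕ.+ n)

-- The Basel sum from the square of the Gregory-Leibniz series

module Basel where

  open import Data.Rational
  open import Data.Rational.Properties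
  open +-*-Solver using (solve; _:+_; _:*_; _:-_; :-_; _:=_; con)
  open import Defs using (leibnizSum; module Leibniz)
  open Leibniz using (sgn; sgn-suc; ∣sgn∣)
  open Rationals

  2ℚ 4ℚ : ℚ
  2ℚ = + 2 / 1
  4ℚ = + 4 / 1

  sgn-+ : ∀ m n → sgn (m ℕ.+ n) ≡ sgn m * sgn n
  sgn-+ zero    n = sym (*-identityˡ (sgn n))
  sgn-+ (suc m) n = begin
    sgn (suc (m ℕ.+ n))   ≡⟨ sgn-suc (m ℕ.+ n) ⟩
    - sgn (m ℕ.+ n)       ≡⟨ cong -_ (sgn-+ m n) ⟩
    - (sgn m * sgn n)     ≡⟨ neg-distribˡ-* (sgn m) (sgn n) ⟩
    - sgn m * sgn n       ≡⟨ cong (_* sgn n) (sgn-suc m) ⟨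
    sgn (suc m) * sgn n   ∎
    where open ≡-Reasoning

  sgn² : ∀ n → sgn n * sgn n ≡ 1ℚ
  sgn² zero    = refl
  sgn² (suc n) = trans (cong₂ _*_ (sgn-suc n) (sgn-suc n))
    (trans (solve 1 (λ s → :- s :* :- s := s :* s) refl (sgn n)) (sgn² n))

  -- The odd reciprocal 1/(2 k + 1): here the size of a Leibniz term, later the probability of
  -- choosing a given edge, as there are 2 t + 1 edges after t steps.
  o : ℕ → ℚ
  o k = inv (2 ℕ.* k)

  o-eq : ∀ k → (1ℚ + 2ℚ * q k) * o k ≡ 1ℚ
  o-eq k = trans (cong (λ x → (1ℚ + x) * o k) (sym q-2*)) (inv-eq (2 ℕ.* k))
    where
    q-2* : q (2 ℕ.* k) ≡ 2ℚ * q k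
    q-2* = trans (q-* 2 k) (cong (_* q k) (sym (/1≡q 2)))

  leibnizSum≡S : ∀ n → leibnizSum n ≡ S (λ k → sgn k * o k) n
  leibnizSum≡S zero    = refl
  leibnizSum≡S (suc n) = cong₂ _+_ (leibnizSum≡S n)
    (trans (Leibniz./-homo-* (-1ℤ ℤ.^ n) (suc (2 ℕ.* n))) (cong (sgn n *_) (1/≡inv (2 ℕ.* n))))

  altTerm : ℕ → ℚ
  altTerm k = sgn k * inv k

  alt : ℕ → ℚ
  alt = S altTerm

  -- A block 1/(j + 1) - 1/(j + 2) + ⋯ of m terms of the alternating harmonic series, without its
  -- leading sign. Recursion from the front lets one induction bound the block between 0 and its
  -- first term.
  gap : ℕ → ℕ → ℚ
  gap j zero    = 0ℚ
  gap j (suc m) = inv j - gap (suc j) m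

  alt-gap : ∀ j m → alt (m ℕ.+ j) ≡ alt j + sgn j * gap j m
  alt-gap j zero    = solve 2 (λ a s → a := a :+ s :* con 0ℚ) refl (alt j) (sgn j)
  alt-gap j (suc m) = begin
    alt (suc m ℕ.+ j)                                        ≡⟨ cong alt (ℕ.+-suc m j) ⟨
    alt (m ℕ.+ suc j)                                        ≡⟨ alt-gap (suc j) m ⟩
    alt j + sgn j * inv j + sgn (suc j) * gap (suc j) m      ≡⟨ cong (λ s → alt j + sgn j * inv j + s * gap (suc j) m) (sgn-suc j) ⟩
    alt j + sgn j * inv j + - sgn j * gap (suc j) m          ≡⟨ solve 4 (λ a s i g → a :+ s :* i :+ :- s :* g := a :+ s :* (i :- g))
                                                                      refl (alt j) (sgn j) (inv j) (gap (suc j) m) ⟩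
    alt j + sgn j * gap j (suc m)                            ∎
    where open ≡-Reasoning

  gap-bounds : ∀ j m → (0ℚ ≤ gap j m) × (gap j m ≤ inv j)
  gap-bounds j zero = ≤-refl , 0≤inv j
  gap-bounds j (suc m) with lo , hi ← gap-bounds (suc j) m =
    0≤- (≤-trans hi (inv-antimono (ℕ.n≤1+n j))) , p-q≤p lo

  alt-close : ∀ j k → j ℕ.≤ k → ∣ alt k - alt j ∣ ≤ inv j
  alt-close j k j≤k = begin
    ∣ alt k - alt j ∣                        ≡⟨ cong (λ k → ∣ alt k - alt j ∣) (ℕ.m∸n+n≡m j≤k) ⟨
    ∣ alt (m ℕ.+ j) - alt j ∣                ≡⟨ cong (λ x → ∣ x - alt j ∣) (alt-gap j m) ⟩
    ∣ alt j + sgn j * gap j m - alt j ∣      ≡⟨ cong ∣_∣ (solve 2 (λ a x → a :+ x :- a := x) refl (alt j) (sgn j * gap j m)) ⟩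
    ∣ sgn j * gap j m ∣                      ≡⟨ ∣p*q∣≡∣p∣*∣q∣ (sgn j) (gap j m) ⟩
    ∣ sgn j ∣ * ∣ gap j m ∣                  ≡⟨ cong₂ _*_ (∣sgn∣ j) (0≤p⇒∣p∣≡p (proj₁ (gap-bounds j m))) ⟩
    1ℚ * gap j m                             ≡⟨ *-identityˡ (gap j m) ⟩
    gap j m                                  ≤⟨ proj₂ (gap-bounds j m) ⟩
    inv j                                    ∎
    where
    open ≤-Reasoning
    m = k ℕ.∸ j

  -- With X + Y = 2N + 1 and X - Y = 2n + 1, where X = N + n + 1 and Y = N - n.
  kernel : ∀ X Y x y p r → X * x ≡ 1ℚ → Y * y ≡ 1ℚ → (X - Y) * p ≡ 1ℚ → (X + Y) * r ≡ 1ℚ →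
           p * (x + y) ≡ r * (4ℚ * p + y - x)
  kernel X Y x y p r e₁ e₂ e₃ e₄ =
    mod₄ (2ℚ * p * r) (X * x) (2ℚ * p * r) (Y * y) (r * (y - x)) ((X - Y) * p) (- (p * (x + y))) ((X + Y) * r)
      e₁ e₂ e₃ e₄
      (solve 6 (λ X Y x y p r → p :* (x :+ y) :- r :* (con 4ℚ :* p :+ y :- x) :=
          con 2ℚ :* p :* r :* (X :* x :- con 1ℚ) :+ con 2ℚ :* p :* r :* (Y :* y :- con 1ℚ)
          :+ r :* (y :- x) :* ((X :- Y) :* p :- con 1ℚ) :+ (:- (p :* (x :+ y))) :* ((X :+ Y) :* r :- con 1ℚ))
        refl X Y x y p r)

  -- Let the index of (-1)^n / (2 n + 1) run over -N ≤ n < N: the sum L and the sum B of squares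
  -- both double. In the off-diagonal part of (2 L)² write 1/((2 m + 1)(2 n + 1)) as (1/(2 n + 1) -
  -- 1/(2 m + 1)) / (2 (m - n)). For fixed n ≥ 0 the sum of (-1)^(m - n) / (m - n) over m ≠ n
  -- cancels symmetrically except for the block with denominators N - n, ..., N + n, which is this
  -- difference of `alt`. The indices n and -n - 1 contribute equally.
  defect : ℕ → ℕ → ℚ
  defect N n = o n * (alt (N ℕ.+ n) - alt (N ℕ.∸ suc n))

  -- The change of `defect` when N grows by one, after `kernel` has traded the factor 1/(2 n + 1)
  -- for 1/(2 N + 1). The new factor is constant in n, so the sum over n can be evaluated.
  increment : ℕ → ℕ → ℚ
  increment N n = o N * (4ℚ * sgn N * (sgn n * o n) - altTerm (N ℕ.∸ suc n) - altTerm (n ℕ.+ N))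

  -- N is given as n + 1 + j so that the truncated subtractions in `defect` reduce to j and j + 1.
  defect-step′ : ∀ n j → defect (suc (suc n ℕ.+ j)) n ≡ defect (suc n ℕ.+ j) n + increment (suc n ℕ.+ j) n
  defect-step′ n j = begin
    o n * (alt (suc N ℕ.+ n) - alt (N ℕ.∸ n))
      ≡⟨ cong (λ u → o n * (alt (suc N ℕ.+ n) - alt u)) (ℕ.+-∸-assoc 1 (ℕ.m≤m+n n j)) ⟩
    o n * (alt (N ℕ.+ n) + altTerm (N ℕ.+ n) - alt (suc (n ℕ.+ j ℕ.∸ n)))
      ≡⟨ cong (λ i → o n * (alt (N ℕ.+ n) + altTerm (N ℕ.+ n) - (alt i + altTerm i))) (ℕ.m+n∸m≡n n j) ⟩
    o n * (alt (N ℕ.+ n) + altTerm (N ℕ.+ n) - (alt j + altTerm j))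
      ≡⟨ solve 5 (λ o a b c d → o :* (a :+ b :- (c :+ d)) := o :* (a :- c) :+ (o :* b :- o :* d))
               refl (o n) (alt (N ℕ.+ n)) (altTerm (N ℕ.+ n)) (alt j) (altTerm j) ⟩
    o n * (alt (N ℕ.+ n) - alt j) + (o n * (sgn (N ℕ.+ n) * x) - o n * (sgn j * y))
      -- N + n = 2 n + 1 + j and j have opposite parity, so the changes at the two ends of the block
      -- reinforce each other. This produces the x + y to which `kernel` applies.
      ≡⟨ cong (λ s → o n * (alt (N ℕ.+ n) - alt j) + (o n * (s * x) - o n * (sgn j * y))) sgn-N+n ⟩
    o n * (alt (N ℕ.+ n) - alt j) + (o n * (- sgn j * x) - o n * (sgn j * y))
      ≡⟨ cong (_+_ (o n * (alt (N ℕ.+ n) - alt j)))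
           (solve 4 (λ o s x y → o :* (:- s :* x) :- o :* (s :* y) := :- s :* (o :* (x :+ y))) refl (o n) (sgn j) x y) ⟩
    o n * (alt (N ℕ.+ n) - alt j) + - sgn j * (o n * (x + y))
      ≡⟨ cong (λ k → o n * (alt (N ℕ.+ n) - alt j) + - sgn j * k)
           (kernel X Y x y (o n) (o N) e₁ (inv-eq j) e₃ e₄) ⟩
    o n * (alt (N ℕ.+ n) - alt j) + - sgn j * (o N * (4ℚ * o n + y - x))
      ≡⟨ cong (_+_ (o n * (alt (N ℕ.+ n) - alt j)))
           (solve 5 (λ s r p x y → :- s :* (r :* (con 4ℚ :* p :+ y :- x)) :=
                      r :* (con 4ℚ :* (:- s) :* p :- s :* y :- (:- s) :* x)) refl (sgn j) (o N) (o n) x y) ⟩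
    o n * (alt (N ℕ.+ n) - alt j) + o N * (4ℚ * (- sgn j) * o n - sgn j * y - (- sgn j) * x)
      ≡⟨ cong (λ k → o n * (alt (N ℕ.+ n) - alt j) + o N * (k - sgn j * y - (- sgn j) * x))
           (trans (cong (λ s → 4ℚ * s * o n) (trans (sym sgn-N+n) (sgn-+ N n)))
                  (solve 3 (λ a b p → con 4ℚ :* (a :* b) :* p := con 4ℚ :* a :* (b :* p)) refl (sgn N) (sgn n) (o n))) ⟩
    o n * (alt (N ℕ.+ n) - alt j) + o N * (4ℚ * sgn N * (sgn n * o n) - altTerm j - (- sgn j) * x)
      ≡⟨ cong (λ s → o n * (alt (N ℕ.+ n) - alt j) + o N * (4ℚ * sgn N * (sgn n * o n) - altTerm j - s * x)) (sym sgn-N+n) ⟩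
    o n * (alt (N ℕ.+ n) - alt j) + o N * (4ℚ * sgn N * (sgn n * o n) - altTerm j - altTerm (N ℕ.+ n))
      ≡⟨ cong₂ (λ i k → o n * (alt (N ℕ.+ n) - alt i) + o N * (4ℚ * sgn N * (sgn n * o n) - altTerm i - altTerm k))
               (sym (ℕ.m+n∸m≡n n j)) (ℕ.+-comm N n) ⟩
    defect N n + increment N n ∎
    where
    open ≡-Reasoning
    N = suc n ℕ.+ j
    x = inv (N ℕ.+ n)
    y = inv j
    X = 1ℚ + (1ℚ + (q n + q j) + q n)
    Y = 1ℚ + q j
    q-N : q N ≡ 1ℚ + (q n + q j)
    q-N = trans (q-suc (n ℕ.+ j)) (cong (_+_ 1ℚ) (q-+ n j))
    e₁ : X * x ≡ 1ℚ
    e₁ = trans (cong (λ k → (1ℚ + k) * x) (sym (trans (q-+ N n) (cong (_+ q n) q-N)))) (inv-eq (N ℕ.+ n))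
    e₃ : (X - Y) * o n ≡ 1ℚ
    e₃ = trans (cong (_* o n) (solve 2 (λ n j → con 1ℚ :+ (con 1ℚ :+ (n :+ j) :+ n) :- (con 1ℚ :+ j) := con 1ℚ :+ con 2ℚ :* n)
                 refl (q n) (q j))) (o-eq n)
    e₄ : (X + Y) * o N ≡ 1ℚ
    e₄ = trans (cong (_* o N) (trans
           (solve 2 (λ n j → con 1ℚ :+ (con 1ℚ :+ (n :+ j) :+ n) :+ (con 1ℚ :+ j) := con 1ℚ :+ con 2ℚ :* (con 1ℚ :+ (n :+ j)))
                  refl (q n) (q j))
           (cong (λ k → 1ℚ + 2ℚ * k) (sym q-N)))) (o-eq N)
    sgn-N+n : sgn (N ℕ.+ n) ≡ - sgn j
    sgn-N+n = begin
      sgn (N ℕ.+ n)               ≡⟨ sgn-suc (n ℕ.+ j ℕ.+ n) ⟩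
      - sgn (n ℕ.+ j ℕ.+ n)       ≡⟨ cong -_ (trans (sgn-+ (n ℕ.+ j) n) (cong (_* sgn n) (sgn-+ n j))) ⟩
      - (sgn n * sgn j * sgn n)   ≡⟨ cong -_ (solve 2 (λ a b → a :* b :* a := (a :* a) :* b) refl (sgn n) (sgn j)) ⟩
      - (sgn n * sgn n * sgn j)   ≡⟨ cong -_ (trans (cong (_* sgn j) (sgn² n)) (*-identityˡ (sgn j))) ⟩
      - sgn j                     ∎

  defect-step : ∀ N n → n ℕ.< N → defect (suc N) n ≡ defect N n + increment N n
  defect-step N n n<N = subst (λ M → defect (suc M) n ≡ defect M n + increment M n)
    (ℕ.m+[n∸m]≡n n<N) (defect-step′ n (N ℕ.∸ suc n))

  -- The indices N - 1 - n and n + N, for n below N, together run once through 0, ..., 2 N - 1, so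
  -- the two alternating families merge into a single partial sum.
  S-increment : ∀ N → S (increment N) N ≡
                o N * (4ℚ * sgn N * leibnizSum N - alt (N ℕ.+ N))
  S-increment N = begin
    S (increment N) N
      ≡⟨ S-* (o N) (λ n → 4ℚ * sgn N * (sgn n * o n) - altTerm (N ℕ.∸ suc n) - altTerm (n ℕ.+ N)) N ⟩
    o N * S (λ n → 4ℚ * sgn N * (sgn n * o n) - altTerm (N ℕ.∸ suc n) - altTerm (n ℕ.+ N)) N
      ≡⟨ cong (o N *_) (S-minus (λ n → 4ℚ * sgn N * (sgn n * o n) - altTerm (N ℕ.∸ suc n)) (λ n → altTerm (n ℕ.+ N)) N) ⟩
    o N * (S (λ n → 4ℚ * sgn N * (sgn n * o n) - altTerm (N ℕ.∸ suc n)) N - tail)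
      ≡⟨ cong (λ x → o N * (x - tail)) (S-minus (λ n → 4ℚ * sgn N * (sgn n * o n)) (λ n → altTerm (N ℕ.∸ suc n)) N) ⟩
    o N * (S (λ n → 4ℚ * sgn N * (sgn n * o n)) N - S (λ n → altTerm (N ℕ.∸ suc n)) N - tail)
      ≡⟨ cong₂ (λ x y → o N * (x - y - tail))
           (trans (S-* (4ℚ * sgn N) (λ n → sgn n * o n) N) (cong (4ℚ * sgn N *_) (sym (leibnizSum≡S N))))
           (S-reverse altTerm N) ⟩
    o N * (4ℚ * sgn N * leibnizSum N - alt N - tail)
      ≡⟨ solve 4 (λ r l a t → r :* (l :- a :- t) := r :* (l :- (a :+ t))) refl (o N) (4ℚ * sgn N * leibnizSum N) (alt N) tail ⟩
    o N * (4ℚ * sgn N * leibnizSum N - (alt N + tail))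
      ≡⟨ cong (λ x → o N * (4ℚ * sgn N * leibnizSum N - x)) (S-append altTerm N N) ⟨
    o N * (4ℚ * sgn N * leibnizSum N - alt (N ℕ.+ N)) ∎
    where
    open ≡-Reasoning
    tail = S (λ n → altTerm (n ℕ.+ N)) N

  oddSquares : ℕ → ℚ
  oddSquares = S (λ k → o k * o k)

  -- A truncated form of  2 (1 - 1/3 + ⋯)² = 1 + 1/3² + ⋯
  leibniz-square : ∀ N → 2ℚ * (leibnizSum N * leibnizSum N) - oddSquares N ≡ S (defect N) N
  leibniz-square zero    = refl
  leibniz-square (suc N) = begin
    2ℚ * (leibnizSum (suc N) * leibnizSum (suc N)) - (oddSquares N + o N * o N)
      ≡⟨ cong (λ t → 2ℚ * ((l + t) * (l + t)) - (oddSquares N + o N * o N))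
           (trans (Leibniz./-homo-* (-1ℤ ℤ.^ N) (suc (2 ℕ.* N))) (cong (sgn N *_) (1/≡inv (2 ℕ.* N)))) ⟩
    2ℚ * ((l + sgn N * o N) * (l + sgn N * o N)) - (oddSquares N + o N * o N)
      ≡⟨ solve 4 (λ l s r b → con 2ℚ :* ((l :+ s :* r) :* (l :+ s :* r)) :- (b :+ r :* r) :=
                    (con 2ℚ :* (l :* l) :- b) :+ (r :* (con 4ℚ :* s :* l) :+ (con 2ℚ :* (s :* s) :- con 1ℚ) :* (r :* r)))
               refl l (sgn N) (o N) (oddSquares N) ⟩
    (2ℚ * (l * l) - oddSquares N) + (o N * (4ℚ * sgn N * l) + (2ℚ * (sgn N * sgn N) - 1ℚ) * (o N * o N))
      ≡⟨ cong₂ (λ x s → x + (o N * (4ℚ * sgn N * l) + (2ℚ * s - 1ℚ) * (o N * o N))) (leibniz-square N) (sgn² N) ⟩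
    S (defect N) N + (o N * (4ℚ * sgn N * l) + (2ℚ * 1ℚ - 1ℚ) * (o N * o N))
      -- Inserting `alt (N + N)` with both signs completes the first bracket to the sum of the
      -- increments. The rest is the new summand `defect (suc N) N`, since the block up to 2 N + 1
      -- ends in the positive term 1/(2 N + 1) and starts after `alt 0`, which is 0.
      ≡⟨ solve 4 (λ d r l a → d :+ (r :* l :+ (con 2ℚ :* con 1ℚ :- con 1ℚ) :* (r :* r)) :=
                    d :+ r :* (l :- a) :+ r :* (a :+ con 1ℚ :* r :- con 0ℚ))
               refl (S (defect N) N) (o N) (4ℚ * sgn N * l) (alt (N ℕ.+ N)) ⟩
    S (defect N) N + o N * (4ℚ * sgn N * l - alt (N ℕ.+ N)) + o N * (alt (N ℕ.+ N) + 1ℚ * o N - 0ℚ)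
      ≡⟨ cong₂ _+_ (trans (cong (_+_ (S (defect N) N)) (sym (S-increment N))) (sym (S-+ (defect N) (increment N) N)))
           (cong₂ (λ s k → o N * (alt (N ℕ.+ N) + s * inv k - 0ℚ))
             (sym (trans (sgn-+ N N) (sgn² N))) (cong (N ℕ.+_) (ℕ.+-identityʳ N))) ⟩
    S (λ n → defect N n + increment N n) N + o N * (alt (suc N ℕ.+ N) - 0ℚ)
      ≡⟨ cong₂ (λ x k → x + o N * (alt (suc N ℕ.+ N) - alt k))
           (S-cong N (λ n n<N → sym (defect-step N n n<N))) (sym (ℕ.n∸n≡0 N)) ⟩
    S (defect (suc N)) (suc N) ∎
    where
    open ≡-Reasoning
    l = leibnizSum N

  -- An alternating block is at most its first term, here 1/(N - n). By `inv-*`, the product with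
  -- 1/(n + 1) ≥ 1/(2 n + 1) equals 1/(N + 1) times 1/(n + 1) + 1/(N - n), and both parts sum to
  -- `H N`.
  leibniz-square-bound : ∀ N → ∣ 2ℚ * (leibnizSum N * leibnizSum N) - oddSquares N ∣ ≤ q 2 * (inv N * H N)
  leibniz-square-bound N = begin
    ∣ 2ℚ * (leibnizSum N * leibnizSum N) - oddSquares N ∣   ≡⟨ cong ∣_∣ (leibniz-square N) ⟩
    ∣ S (defect N) N ∣                                      ≤⟨ S-∣∣ (defect N) N ⟩
    S (λ n → ∣ defect N n ∣) N                              ≤⟨ S-mono N term ⟩
    S (λ n → inv N * (inv n + inv (N ℕ.∸ suc n))) N         ≡⟨ S-* (inv N) (λ n → inv n + inv (N ℕ.∸ suc n)) N ⟩
    inv N * S (λ n → inv n + inv (N ℕ.∸ suc n)) N           ≡⟨ cong (inv N *_) (trans (S-+ inv (λ n → inv (N ℕ.∸ suc n)) N)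
                                                                 (cong (_+_ (H N)) (S-reverse inv N))) ⟩
    inv N * (H N + H N)                                     ≡⟨ solve 2 (λ i h → i :* (h :+ h) := con 2ℚ :* (i :* h)) refl (inv N) (H N) ⟩
    2ℚ * (inv N * H N)                                      ≡⟨ cong (_* (inv N * H N)) (/1≡q 2) ⟩
    q 2 * (inv N * H N)                                     ∎
    where
    open ≤-Reasoning
    term : ∀ n → n ℕ.< N → ∣ defect N n ∣ ≤ inv N * (inv n + inv (N ℕ.∸ suc n))
    term n n<N = begin
      ∣ defect N n ∣                                      ≡⟨ ∣p*q∣≡∣p∣*∣q∣ (o n) (alt (N ℕ.+ n) - alt j) ⟩
      ∣ o n ∣ * ∣ alt (N ℕ.+ n) - alt j ∣                 ≡⟨ cong (_* ∣ alt (N ℕ.+ n) - alt j ∣) (0≤p⇒∣p∣≡p (0≤inv (2 ℕ.* n))) ⟩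
      o n * ∣ alt (N ℕ.+ n) - alt j ∣                     ≤⟨ *-mono-≤ (0≤∣p∣ (alt (N ℕ.+ n) - alt j)) (0≤inv n)
                                                               (inv-antimono (ℕ.m≤m+n n (n ℕ.+ 0)))
                                                               (alt-close j (N ℕ.+ n) (ℕ.≤-trans (ℕ.m∸n≤m N (suc n)) (ℕ.m≤m+n N n))) ⟩
      inv n * inv j                                       ≡⟨ inv-* n j ⟩
      inv (suc n ℕ.+ j) * (inv n + inv j)                 ≡⟨ cong (λ k → inv k * (inv n + inv j)) (ℕ.m+[n∸m]≡n n<N) ⟩
      inv N * (inv n + inv j)                             ∎
      where j = N ℕ.∸ suc n

  -- From the odd squares to all squares

  squares : ℕ → ℚ
  squares = S (λ k → inv k * inv k)

  inv-odd : ∀ n → inv (suc (2 ℕ.* n)) ≡ ½ * inv n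
  inv-odd n = mod₂ (½ * y) ((1ℚ + (1ℚ + 2ℚ * q n)) * x) (- x) ((1ℚ + q n) * y)
    (trans (cong (λ k → (1ℚ + k) * x) (sym (trans (q-suc (2 ℕ.* n)) (cong (_+_ 1ℚ) (trans (q-* 2 n) (cong (_* q n) (sym (/1≡q 2))))))))
           (inv-eq (suc (2 ℕ.* n))))
    (inv-eq n)
    (solve 3 (λ a x y → x :- con ½ :* y := con ½ :* y :* ((con 1ℚ :+ (con 1ℚ :+ con 2ℚ :* a)) :* x :- con 1ℚ)
        :+ (:- x) :* ((con 1ℚ :+ a) :* y :- con 1ℚ)) refl (q n) x y)
    where
    x = inv (suc (2 ℕ.* n))
    y = inv n

  -- Odd and even denominators are separated; the even ones give a quarter of the shorter sum.
  squares-double : ∀ n → squares (2 ℕ.* n) ≡ oddSquares n + ½ * ½ * squares n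
  squares-double zero    = refl
  squares-double (suc n) = begin
    squares (2 ℕ.* suc n)
      ≡⟨ cong squares (ℕ.*-suc 2 n) ⟩
    squares (2 ℕ.* n) + o n * o n + e * e
      ≡⟨ cong₂ (λ x y → x + o n * o n + y * y) (squares-double n) (inv-odd n) ⟩
    oddSquares n + ½ * ½ * squares n + o n * o n + ½ * inv n * (½ * inv n)
      ≡⟨ solve 4 (λ a b r i → a :+ con ½ :* con ½ :* b :+ r :* r :+ con ½ :* i :* (con ½ :* i) :=
                    a :+ r :* r :+ con ½ :* con ½ :* (b :+ i :* i)) refl (oddSquares n) (squares n) (o n) (inv n) ⟩
    oddSquares (suc n) + ½ * ½ * squares (suc n) ∎
    where
    open ≡-Reasoning
    e = inv (suc (2 ℕ.* n))

  squares-tail : ∀ n → S (λ k → inv (k ℕ.+ n) * inv (k ℕ.+ n)) n ≤ inv n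
  squares-tail n = begin
    S (λ k → inv (k ℕ.+ n) * inv (k ℕ.+ n)) n   ≤⟨ S-const-≤ (inv n * inv n) n (λ k _ →
                                                      *-mono-≤ (0≤inv (k ℕ.+ n)) (0≤inv n) (inv-antimono (ℕ.m≤n+m n k)) (inv-antimono (ℕ.m≤n+m n k))) ⟩
    q n * (inv n * inv n)                       ≡⟨ *-assoc (q n) (inv n) (inv n) ⟨
    q n * inv n * inv n                         ≤⟨ *-monoʳ-≤-nonNeg (inv n) {{nonNegative (0≤inv n)}} (q*inv≤1 (ℕ.n≤1+n n)) ⟩
    1ℚ * inv n                                  ≡⟨ *-identityˡ (inv n) ⟩
    inv n                                       ∎
    where open ≤-Reasoning

  0≤squares-tail : ∀ n m → 0ℚ ≤ S (λ k → inv (k ℕ.+ n) * inv (k ℕ.+ n)) m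
  0≤squares-tail n zero    = ≤-refl
  0≤squares-tail n (suc m) = 0≤+ (0≤squares-tail n m) (0≤* (0≤inv (m ℕ.+ n)) (0≤inv (m ℕ.+ n)))

  -- ∑ 1/k² = π²/6, in the form  12 ∑ 1/k² - 32 (π/4)² → 0.
  basel : Null (λ n → (+ 12 / 1) * squares n - (+ 32 / 1) * (leibnizSum n * leibnizSum n))
  basel = Null-cong eq
    -- By `relation` the odd squares are ¾ of `squares n` plus `tail n`. Hence 16 times the odd
    -- squares minus `tail n` is 12 `squares n`, and the factor 16 also turns 2 into the 32 of the
    -- claim.
    (Null-+ (Null-q* 16 (Null-neg (Null-≤ leibniz-square-bound (Null-q* 2 Null-H))))
            (Null-q* 16 (Null-neg (Null-≤ tail-bound Null-inv))))
    where
    tail : ℕ → ℚ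
    tail n = S (λ k → inv (k ℕ.+ n) * inv (k ℕ.+ n)) n
    tail-bound : ∀ n → ∣ tail n ∣ ≤ inv n
    tail-bound n = ≤-trans (≤-reflexive (0≤p⇒∣p∣≡p (0≤squares-tail n n))) (squares-tail n)
    relation : ∀ n → squares n + tail n ≡ oddSquares n + ½ * ½ * squares n
    relation n = trans (sym (S-append (λ k → inv k * inv k) n n))
      (trans (cong squares (cong (n ℕ.+_) (sym (ℕ.+-identityʳ n)))) (squares-double n))
    eq : ∀ n → q 16 * (- (2ℚ * (leibnizSum n * leibnizSum n) - oddSquares n)) + q 16 * (- tail n) ≡
               (+ 12 / 1) * squares n - (+ 32 / 1) * (leibnizSum n * leibnizSum n)
    eq n = begin
      q 16 * (- (2ℚ * ll - oddSquares n)) + q 16 * (- tail n)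
        ≡⟨ cong (λ k → k * (- (2ℚ * ll - oddSquares n)) + k * (- tail n)) (sym (/1≡q 16)) ⟩
      (+ 16 / 1) * (- (2ℚ * ll - oddSquares n)) + (+ 16 / 1) * (- tail n)
        ≡⟨ solve 4 (λ l b t z → con (+ 16 / 1) :* (:- (con 2ℚ :* l :- b)) :+ con (+ 16 / 1) :* (:- t) :=
             con (+ 16 / 1) :* ((b :+ con ½ :* con ½ :* z) :- (z :+ t)) :+ (con (+ 12 / 1) :* z :- con (+ 32 / 1) :* l))
             refl ll (oddSquares n) (tail n) (squares n) ⟩
      (+ 16 / 1) * ((oddSquares n + ½ * ½ * squares n) - (squares n + tail n)) + goal
        ≡⟨ cong (λ x → (+ 16 / 1) * (x - (squares n + tail n)) + goal) (sym (relation n)) ⟩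
      (+ 16 / 1) * ((squares n + tail n) - (squares n + tail n)) + goal
        ≡⟨ solve 2 (λ x g → con (+ 16 / 1) :* (x :- x) :+ g := g) refl (squares n + tail n) goal ⟩
      goal ∎
      where
      open ≡-Reasoning
      ll = leibnizSum n * leibnizSum n
      goal = (+ 12 / 1) * squares n - (+ 32 / 1) * ll

-- The recursion for the degree counts and its asymptotics

module DegreeLaw where

  open import Data.Rational
  open import Data.Rational.Properties
  open +-*-Solver using (solve; _:+_; _:*_; _:-_; :-_; _:=_; con)
  open import Defs using (clusteringFormula; leibnizSum)
  open Rationals
  open Basel

  3ℚ 6ℚ 12ℚ 18ℚ 19ℚ 24ℚ : ℚ
  3ℚ = + 3 / 1
  6ℚ = + 6 / 1
  12ℚ = + 12 / 1
  18ℚ = + 18 / 1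
  19ℚ = + 19 / 1
  24ℚ = + 24 / 1

  clustering : ℕ → ℚ
  clustering d = clusteringFormula d (d ℕ.∸ 1)

  clustering-2+ : ∀ k → clustering (2 ℕ.+ k) ≡ 2ℚ * inv (suc k)
  clustering-2+ k = trans (/≡q*inv (2 ℕ.* suc k) (k ℕ.+ suc k ℕ.* suc k))
    (trans (cong (_* z) (trans (q-* 2 (suc k)) (cong (_* a) (sym (/1≡q 2)))))
    (mod₂ (- (2ℚ * a * z)) ((1ℚ + a) * y) (2ℚ * y) ((1ℚ + a) * a * z) (inv-eq (suc k))
      (trans (cong (_* z) (trans (cong (_* a) (sym (q-suc (suc k)))) (sym (q-* (suc (suc k)) (suc k)))))
             (inv-cancel (k ℕ.+ suc k ℕ.* suc k)))
      (solve 3 (λ a y z → con 2ℚ :* a :* z :- con 2ℚ :* y :=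
         (:- (con 2ℚ :* a :* z)) :* ((con 1ℚ :+ a) :* y :- con 1ℚ)
         :+ con 2ℚ :* y :* ((con 1ℚ :+ a) :* a :* z :- con 1ℚ)) refl a y z)))
    where
    a = q (suc k)
    y = inv (suc k)
    z = inv (k ℕ.+ suc k ℕ.* suc k)

  inv-diff : ∀ d n → q d * (inv n * inv (d ℕ.+ n)) ≡ inv n - inv (d ℕ.+ n)
  inv-diff d n = mod₂ x ((1ℚ + (q d + q n)) * z) (- z) ((1ℚ + q n) * x)
    (trans (cong (λ k → (1ℚ + k) * z) (sym (q-+ d n))) (inv-eq (d ℕ.+ n))) (inv-eq n)
    (solve 4 (λ d n x z → d :* (x :* z) :- (x :- z) :=
       x :* ((con 1ℚ :+ (d :+ n)) :* z :- con 1ℚ) :+ (:- z) :* ((con 1ℚ :+ n) :* x :- con 1ℚ)) refl (q d) (q n) x z)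
    where
    x = inv n
    z = inv (d ℕ.+ n)

  inv≤2inv : ∀ n → inv n ≤ 2ℚ * inv (suc n)
  inv≤2inv n = begin
    x                ≡⟨ solve 2 (λ x y → x := (x :- y) :+ y) refl x y ⟩
    (x - y) + y      ≡⟨ cong (_+ y) (inv-diff 1 n) ⟨
    q 1 * (x * y) + y ≡⟨ cong (λ k → k * (x * y) + y) (/1≡q 1) ⟨
    1ℚ * (x * y) + y ≤⟨ +-monoˡ-≤ y (*-monoʳ 1ℚ (≤ᵇ⇒≤ tt) (*-monoʳ-≤-nonNeg y {{nonNegative (0≤inv (suc n))}} (inv≤1 n))) ⟩
    1ℚ * (1ℚ * y) + y ≡⟨ solve 1 (λ y → con 1ℚ :* (con 1ℚ :* y) :+ y := con 2ℚ :* y) refl y ⟩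
    2ℚ * y           ∎
    where
    open ≤-Reasoning
    x = inv n
    y = inv (suc n)

  0≤clustering : ∀ d → 0ℚ ≤ clustering d
  0≤clustering 0             = ≤-refl
  0≤clustering 1             = ≤-refl
  0≤clustering (suc (suc k)) = subst (0ℚ ≤_) (sym (clustering-2+ k)) (0≤* {2ℚ} {inv (suc k)} (≤ᵇ⇒≤ tt) (0≤inv (suc k)))

  -- The constant is generous so that one bound by 1/(d + 1) covers all d; sums over degrees are
  -- then compared directly with `H`.
  clustering≤ : ∀ d → clustering d ≤ 4ℚ * inv d
  clustering≤ 0             = 0≤* {4ℚ} {inv 0} (≤ᵇ⇒≤ tt) (0≤inv 0)
  clustering≤ 1             = 0≤* {4ℚ} {inv 1} (≤ᵇ⇒≤ tt) (0≤inv 1)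
  clustering≤ (suc (suc k)) = begin
    clustering (2 ℕ.+ k)           ≡⟨ clustering-2+ k ⟩
    2ℚ * inv (suc k)               ≤⟨ *-monoʳ 2ℚ (≤ᵇ⇒≤ tt) (inv≤2inv (suc k)) ⟩
    2ℚ * (2ℚ * inv (2 ℕ.+ k))      ≡⟨ *-assoc 2ℚ 2ℚ (inv (2 ℕ.+ k)) ⟨
    4ℚ * inv (2 ℕ.+ k)             ∎
    where open ≤-Reasoning

  -- The limiting proportion of vertices of degree d.
  limit : ℕ → ℚ
  limit 0             = 0ℚ
  limit 1             = 0ℚ
  limit (suc (suc k)) = 12ℚ * (inv (1 ℕ.+ k) * inv (2 ℕ.+ k) * inv (3 ℕ.+ k))

  -- The source term for the newly added vertex. The recursions are stated at `suc d`, so its degree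
  -- 2 is marked at d = 1.
  δ₁ : ℕ → ℚ
  δ₁ 1 = 1ℚ
  δ₁ _ = 0ℚ

  inv-1 : inv 1 ≡ ½
  inv-1 = sym (1/≡inv 1)

  inv-2 : inv 2 ≡ + 1 / 3
  inv-2 = sym (1/≡inv 2)

  inv-3 : inv 3 ≡ + 1 / 4
  inv-3 = sym (1/≡inv 3)

  -- The equation that makes `limit d` times t + ½ an exact solution of the count recursion. The
  -- product formula has successive ratio d / (d + 3), and the case d = 1 fixes the factor 12,
  -- through p_2 = ½.
  limit-rec : ∀ d → (2ℚ + q (suc d)) * limit (suc d) ≡ q d * limit d + 2ℚ * δ₁ d
  limit-rec 0 = solve 2 (λ a b → (con 2ℚ :+ a) :* con 0ℚ := b :* con 0ℚ :+ con 2ℚ :* con 0ℚ) refl (q 1) (q 0)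
  limit-rec 1 = begin
    (2ℚ + q 2) * (12ℚ * (inv 1 * inv 2 * inv 3))   ≡⟨ cong₂ (λ a b → (2ℚ + a) * (12ℚ * b)) (sym (/1≡q 2)) (cong₂ _*_ (cong₂ _*_ inv-1 inv-2) inv-3) ⟩
    2ℚ                                             ≡⟨ cong (_+ 2ℚ * 1ℚ) (*-zeroʳ (q 1)) ⟨
    q 1 * 0ℚ + 2ℚ * 1ℚ                             ∎
    where open ≡-Reasoning
  limit-rec (suc (suc k)) = begin
    (2ℚ + q (3 ℕ.+ k)) * (12ℚ * (y * z * w))
      ≡⟨ cong (λ a → (2ℚ + a) * (12ℚ * (y * z * w))) (q-+ 3 k) ⟩
    (2ℚ + (q 3 + a)) * (12ℚ * (y * z * w))
      ≡⟨ cong (λ b → (2ℚ + (b + a)) * (12ℚ * (y * z * w))) (/1≡q 3) ⟨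
    (2ℚ + (3ℚ + a)) * (12ℚ * (y * z * w))
      ≡⟨ mod₂ (12ℚ * y * z) ((1ℚ + (4ℚ + a)) * w) (- (12ℚ * y * z)) ((1ℚ + (1ℚ + a)) * x)
          (trans (cong (λ b → (1ℚ + b) * w) (sym (trans (q-+ 4 k) (cong (_+ a) (sym (/1≡q 4)))))) (inv-eq (4 ℕ.+ k)))
          (trans (cong (λ b → (1ℚ + b) * x) (sym (q-suc k))) (inv-eq (1 ℕ.+ k)))
          (solve 5 (λ a x y z w → (con 2ℚ :+ (con 3ℚ :+ a)) :* (con 12ℚ :* (y :* z :* w)) :- (con 2ℚ :+ a) :* (con 12ℚ :* (x :* y :* z)) :=
            con 12ℚ :* y :* z :* ((con 1ℚ :+ (con 4ℚ :+ a)) :* w :- con 1ℚ) :+ (:- (con 12ℚ :* y :* z)) :* ((con 1ℚ :+ (con 1ℚ :+ a)) :* x :- con 1ℚ))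
            refl a x y z w) ⟩
    (2ℚ + a) * (12ℚ * (x * y * z))
      ≡⟨ cong (λ b → (b + a) * (12ℚ * (x * y * z))) (/1≡q 2) ⟩
    (q 2 + a) * (12ℚ * (x * y * z))
      ≡⟨ cong (_* (12ℚ * (x * y * z))) (q-+ 2 k) ⟨
    q (2 ℕ.+ k) * (12ℚ * (x * y * z))
      ≡⟨ solve 1 (λ u → u := u :+ con 2ℚ :* con 0ℚ) refl (q (2 ℕ.+ k) * (12ℚ * (x * y * z))) ⟩
    q (2 ℕ.+ k) * (12ℚ * (x * y * z)) + 2ℚ * 0ℚ ∎
    where
    open ≡-Reasoning
    a = q k
    x = inv (1 ℕ.+ k)
    y = inv (2 ℕ.+ k)
    z = inv (3 ℕ.+ k)
    w = inv (4 ℕ.+ k)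

  -- The upper bound comes from (k + 3)(k + 4) ≥ 12.
  limit-bounds : ∀ k → (0ℚ ≤ limit (2 ℕ.+ k)) × (limit (2 ℕ.+ k) ≤ inv (1 ℕ.+ k))
  limit-bounds k =
      0≤* {12ℚ} {inv (1 ℕ.+ k) * inv (2 ℕ.+ k) * inv (3 ℕ.+ k)} (≤ᵇ⇒≤ tt) (0≤* (0≤* (0≤inv (1 ℕ.+ k)) (0≤inv (2 ℕ.+ k))) (0≤inv (3 ℕ.+ k)))
    , (begin
    12ℚ * (x * y * z)                 ≡⟨ solve 3 (λ x y z → con 12ℚ :* (x :* y :* z) := con 12ℚ :* x :* (y :* z)) refl x y z ⟩
    12ℚ * x * (y * z)                 ≤⟨ *-monoʳ (12ℚ * x) (0≤* {12ℚ} {inv (1 ℕ.+ k)} (≤ᵇ⇒≤ tt) (0≤inv (1 ℕ.+ k)))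
                                           (*-mono-≤ (0≤inv (3 ℕ.+ k)) (0≤inv 2) (inv-antimono (ℕ.m≤m+n 2 k)) (inv-antimono (ℕ.m≤m+n 3 k))) ⟩
    12ℚ * x * (inv 2 * inv 3)         ≡⟨ cong (12ℚ * x *_) (cong₂ _*_ inv-2 inv-3) ⟩
    12ℚ * x * ((+ 1 / 3) * (+ 1 / 4)) ≡⟨ solve 1 (λ x → con 12ℚ :* x :* (con (+ 1 / 3) :* con (+ 1 / 4)) := x) refl x ⟩
    x                                 ∎)
    where
    open ≤-Reasoning
    x = inv (1 ℕ.+ k)
    y = inv (2 ℕ.+ k)
    z = inv (3 ℕ.+ k)

  0≤limit : ∀ d → 0ℚ ≤ limit d
  0≤limit 0             = ≤-refl
  0≤limit 1             = ≤-refl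
  0≤limit (suc (suc k)) = proj₁ (limit-bounds k)

  limit≤1 : ∀ d → limit d ≤ 1ℚ
  limit≤1 0             = ≤ᵇ⇒≤ tt
  limit≤1 1             = ≤ᵇ⇒≤ tt
  limit≤1 (suc (suc k)) = ≤-trans (proj₂ (limit-bounds k)) (inv≤1 (1 ℕ.+ k))

  -- The expected number of vertices of degree d after t steps, when there are 2 t + 1 edges.
  count : ℕ → ℕ → ℚ
  count zero    1       = 2ℚ
  count zero    _       = 0ℚ
  count (suc t) zero    = 0ℚ
  count (suc t) (suc d) = (1ℚ - q (suc d) * o t) * count t (suc d) + q d * o t * count t d + δ₁ d

  count-0 : ∀ t → count t 0 ≡ 0ℚ
  count-0 zero    = refl
  count-0 (suc t) = refl

  -- Degrees start at 1 and grow by at most one per step, so none exceeds t + 1. Sums over degrees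
  -- below t + 2 are therefore complete.
  count-support : ∀ t k → count t (t ℕ.+ 2 ℕ.+ k) ≡ 0ℚ
  count-support zero    k = refl
  count-support (suc t) k = begin
    (1ℚ - q (suc d) * o t) * count t (suc d) + q d * o t * count t d + δ₁ d
      ≡⟨ cong₂ (λ x y → (1ℚ - q (suc d) * o t) * x + q d * o t * y + δ₁ d)
           (trans (cong (count t) (sym (ℕ.+-suc (t ℕ.+ 2) k))) (count-support t (suc k))) (count-support t k) ⟩
    (1ℚ - q (suc d) * o t) * 0ℚ + q d * o t * 0ℚ + δ₁ d
      ≡⟨ solve 3 (λ a b c → a :* con 0ℚ :+ b :* con 0ℚ :+ c := c) refl (1ℚ - q (suc d) * o t) (q d * o t) (δ₁ d) ⟩
    δ₁ d
      ≡⟨ cong δ₁ (cong (ℕ._+ k) (ℕ.+-comm t 2)) ⟩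
    0ℚ ∎
    where
    open ≡-Reasoning
    d = t ℕ.+ 2 ℕ.+ k

  -- The expected value of g at the degree of a vertex after one step: a vertex of degree d is an
  -- end of the chosen edge with probability d / (2 t + 1).
  growth : ℕ → (ℕ → ℚ) → ℕ → ℚ
  growth t g d = g d + o t * (q d * (g (suc d) - g d))

  S-δ₁ : ∀ (g : ℕ → ℚ) t → S (λ d → δ₁ d * g d) (2 ℕ.+ t) ≡ g 1
  S-δ₁ g zero    = solve 2 (λ a b → con 0ℚ :+ con 0ℚ :* a :+ con 1ℚ :* b := b) refl (g 0) (g 1)
  S-δ₁ g (suc t) = trans (solve 2 (λ s x → s :+ con 0ℚ :* x := s) refl (S (λ d → δ₁ d * g d) (2 ℕ.+ t)) (g (2 ℕ.+ t))) (S-δ₁ g t)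

  -- The recursion of `count` is the transpose of `growth t`, and its source term contributes g 2.
  -- The index shift leaves the boundary terms `A 0` and `A (2 + t)`, which vanish because no vertex
  -- has degree 0 or t + 2.
  count-step : ∀ t g → S (λ d → count (suc t) d * g d) (3 ℕ.+ t) ≡
                       S (λ d → count t d * growth t g d) (2 ℕ.+ t) + g 2
  count-step t g = begin
    S (λ d → count (suc t) d * g d) (3 ℕ.+ t)
      ≡⟨ S-suc (λ d → count (suc t) d * g d) (2 ℕ.+ t) ⟩
    0ℚ * g 0 + S (λ d → count (suc t) (suc d) * g (suc d)) (2 ℕ.+ t)
      ≡⟨ cong (_+_ (0ℚ * g 0)) (trans (S-cong (2 ℕ.+ t) (λ d _ → split d))
           (trans (S-+ (λ d → A (suc d) + B d) (λ d → δ₁ d * g (suc d)) (2 ℕ.+ t))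
                  (cong₂ _+_ (S-+ (A ∘ suc) B (2 ℕ.+ t)) (S-δ₁ (g ∘ suc) t)))) ⟩
    0ℚ * g 0 + (S (A ∘ suc) (2 ℕ.+ t) + S B (2 ℕ.+ t) + g 2)
      ≡⟨ solve 5 (λ a s b c g → con 0ℚ :* g :+ (s :+ b :+ c) := (a :+ s) :+ (b :+ c) :- a) refl
               (A 0) (S (A ∘ suc) (2 ℕ.+ t)) (S B (2 ℕ.+ t)) (g 2) (g 0) ⟩
    (A 0 + S (A ∘ suc) (2 ℕ.+ t)) + (S B (2 ℕ.+ t) + g 2) - A 0
      ≡⟨ cong (λ x → x + (S B (2 ℕ.+ t) + g 2) - A 0) (S-suc A (2 ℕ.+ t)) ⟨
    S A (2 ℕ.+ t) + A (2 ℕ.+ t) + (S B (2 ℕ.+ t) + g 2) - A 0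
      ≡⟨ cong₂ (λ x y → S A (2 ℕ.+ t) + x + (S B (2 ℕ.+ t) + g 2) - y) A-last A-first ⟩
    S A (2 ℕ.+ t) + 0ℚ + (S B (2 ℕ.+ t) + g 2) - 0ℚ
      ≡⟨ solve 3 (λ a b c → a :+ con 0ℚ :+ (b :+ c) :- con 0ℚ := a :+ b :+ c) refl (S A (2 ℕ.+ t)) (S B (2 ℕ.+ t)) (g 2) ⟩
    S A (2 ℕ.+ t) + S B (2 ℕ.+ t) + g 2
      ≡⟨ cong (_+ g 2) (trans (sym (S-+ A B (2 ℕ.+ t))) (S-cong (2 ℕ.+ t) (λ d _ → merge d))) ⟩
    S (λ d → count t d * growth t g d) (2 ℕ.+ t) + g 2 ∎
    where
    open ≡-Reasoning
    A B : ℕ → ℚ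
    A d = (1ℚ - q d * o t) * count t d * g d
    B d = q d * o t * count t d * g (suc d)
    split : ∀ d → count (suc t) (suc d) * g (suc d) ≡ A (suc d) + B d + δ₁ d * g (suc d)
    split d = solve 4 (λ x y z g → (x :+ y :+ z) :* g := x :* g :+ y :* g :+ z :* g) refl
      ((1ℚ - q (suc d) * o t) * count t (suc d)) (q d * o t * count t d) (δ₁ d) (g (suc d))
    merge : ∀ d → A d + B d ≡ count t d * growth t g d
    merge d = solve 5 (λ a r n g h → (con 1ℚ :- a :* r) :* n :* g :+ a :* r :* n :* h := n :* (g :+ r :* (a :* (h :- g))))
      refl (q d) (o t) (count t d) (g d) (g (suc d))
    A-last : A (2 ℕ.+ t) ≡ 0ℚ
    A-last = trans (cong (λ n → (1ℚ - q (2 ℕ.+ t) * o t) * n * g (2 ℕ.+ t))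
        (trans (cong (count t) (trans (ℕ.+-comm 2 t) (sym (ℕ.+-identityʳ (t ℕ.+ 2))))) (count-support t 0)))
      (solve 2 (λ a g → a :* con 0ℚ :* g := con 0ℚ) refl (1ℚ - q (2 ℕ.+ t) * o t) (g (2 ℕ.+ t)))
    A-first : A 0 ≡ 0ℚ
    A-first = trans (cong (λ n → (1ℚ - q 0 * o t) * n * g 0) (count-0 t))
      (solve 2 (λ a g → a :* con 0ℚ :* g := con 0ℚ) refl (1ℚ - q 0 * o t) (g 0))

  -- The correction ½ makes the deviation satisfy the recurrence of the counts without
  -- its inhomogeneous term.
  deviation : ℕ → ℕ → ℚ
  deviation t d = count t d - limit d * (q t + ½)

  -- t + ½ is half the number of edges.
  o-½ : ∀ t → o t * (q t + ½) ≡ ½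
  o-½ t = mod₁ ½ ((1ℚ + 2ℚ * q t) * o t) (o-eq t)
    (solve 2 (λ a r → r :* (a :+ con ½) :- con ½ := con ½ :* ((con 1ℚ :+ con 2ℚ :* a) :* r :- con 1ℚ)) refl (q t) (o t))

  -- Since (t + ½) / (2 t + 1) = ½, the terms not carried by the deviations no longer depend on t.
  -- They form half the difference of the two sides of `limit-rec`.
  deviation-rec : ∀ t d → deviation (suc t) (suc d) ≡
                  (1ℚ - q (suc d) * o t) * deviation t (suc d) + q d * o t * deviation t d
  deviation-rec t d = begin
    α * n′ + β * n + δ₁ d - p′ * (q (suc t) + ½)
      ≡⟨ cong (λ k → α * n′ + β * n + δ₁ d - p′ * (k + ½)) (q-suc t) ⟩
    α * n′ + β * n + δ₁ d - p′ * (1ℚ + q t + ½)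
      ≡⟨ solve 8 (λ a n b m δ p t p₀ → a :* n :+ b :* m :+ δ :- p :* (con 1ℚ :+ t :+ con ½) :=
           a :* (n :- p :* (t :+ con ½)) :+ b :* (m :- p₀ :* (t :+ con ½))
           :+ (δ :+ b :* p₀ :* (t :+ con ½) :- (con 1ℚ :- a) :* p :* (t :+ con ½) :- p))
           refl α n′ β n (δ₁ d) p′ (q t) p ⟩
    goal + (δ₁ d + β * p * (q t + ½) - (1ℚ - α) * p′ * (q t + ½) - p′)
      ≡⟨ cong (λ x → goal + x) (solve 7 (λ δ a b r t p p₀ →
              δ :+ a :* r :* p₀ :* t :- (con 1ℚ :- (con 1ℚ :- b :* r)) :* p :* t :- p
              := δ :+ a :* p₀ :* (r :* t) :- b :* p :* (r :* t) :- p) refl (δ₁ d) (q d) (q (suc d)) (o t) (q t + ½) p′ p) ⟩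
    goal + (δ₁ d + q d * p * (o t * (q t + ½)) - q (suc d) * p′ * (o t * (q t + ½)) - p′)
      ≡⟨ cong (λ h → goal + (δ₁ d + q d * p * h - q (suc d) * p′ * h - p′)) (o-½ t) ⟩
    goal + (δ₁ d + q d * p * ½ - q (suc d) * p′ * ½ - p′)
      ≡⟨ solve 6 (λ g δ a b p₀ p → g :+ (δ :+ a :* p₀ :* con ½ :- b :* p :* con ½ :- p) :=
              g :+ con ½ :* ((a :* p₀ :+ con 2ℚ :* δ) :- (con 2ℚ :+ b) :* p)) refl goal (δ₁ d) (q d) (q (suc d)) p p′ ⟩
    goal + ½ * ((q d * p + 2ℚ * δ₁ d) - (2ℚ + q (suc d)) * p′)
      ≡⟨ cong (λ x → goal + ½ * (x - (2ℚ + q (suc d)) * p′)) (sym (limit-rec d)) ⟩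
    goal + ½ * ((2ℚ + q (suc d)) * p′ - (2ℚ + q (suc d)) * p′)
      ≡⟨ solve 2 (λ g x → g :+ con ½ :* (x :- x) := g) refl goal ((2ℚ + q (suc d)) * p′) ⟩
    goal ∎
    where
    open ≡-Reasoning
    α = 1ℚ - q (suc d) * o t
    β = q d * o t
    n = count t d
    n′ = count t (suc d)
    p = limit d
    p′ = limit (suc d)
    goal = α * deviation t (suc d) + β * deviation t d

  ∣p-q∣≤ : ∀ {p q r} → 0ℚ ≤ p → p ≤ r → 0ℚ ≤ q → q ≤ r → ∣ p - q ∣ ≤ r
  ∣p-q∣≤ {p} {q} 0≤p p≤r 0≤q q≤r with ∣p∣≡p∨∣p∣≡-p (p - q)
  ... | inj₁ eq rewrite eq = ≤-trans (p-q≤p 0≤q) p≤r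
  ... | inj₂ eq rewrite eq = ≤-trans (≤-reflexive (solve 2 (λ p q → :- (p :- q) := q :- p) refl p q))
                                     (≤-trans (p-q≤p 0≤p) q≤r)

  -- For t ≥ 2 these degrees lie outside the support, as t + 2 ≤ 2 t. What remains is the initial
  -- edge and the triangle, whose three vertices of degree 2 account for the bound 3.
  count-large : ∀ t d → 2 ℕ.* t ℕ.≤ d → (0ℚ ≤ count t d) × (count t d ≤ 3ℚ)
  count-large zero 0 _ = ≤ᵇ⇒≤ tt , ≤ᵇ⇒≤ tt
  count-large zero 1 _ = ≤ᵇ⇒≤ tt , ≤ᵇ⇒≤ tt
  count-large zero (suc (suc d)) _ = ≤ᵇ⇒≤ tt , ≤ᵇ⇒≤ tt
  count-large (suc zero) (suc (suc zero)) _ = ≤-trans (≤ᵇ⇒≤ tt) (≤-reflexive (sym eq)) , ≤-reflexive eq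
    where
    eq : count 1 2 ≡ 3ℚ
    eq = trans (cong₂ (λ a b → (1ℚ - q 2 * inv 0) * 0ℚ + a * b * 2ℚ + 1ℚ) (sym (/1≡q 1)) inv-zero)
               (solve 1 (λ x → x :* con 0ℚ :+ con 1ℚ :* con 1ℚ :* con 2ℚ :+ con 1ℚ := con 3ℚ) refl (1ℚ - q 2 * inv 0))
  count-large (suc zero) (suc (suc (suc d))) _ = ≤-reflexive (sym eq) , ≤-trans (≤-reflexive eq) (≤ᵇ⇒≤ tt)
    where
    eq : count 1 (3 ℕ.+ d) ≡ 0ℚ
    eq = count-support 1 d
  count-large (suc zero) 1 (ℕ.s≤s ())
  count-large (suc (suc t)) d h = ≤-reflexive (sym eq) , ≤-trans (≤-reflexive eq) (≤ᵇ⇒≤ tt)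
    where
    bound : suc (suc t) ℕ.+ 2 ℕ.≤ d
    bound = ℕ.≤-trans (ℕ.+-monoʳ-≤ (2 ℕ.+ t) {2} {suc (suc (t ℕ.+ 0))} (ℕ.s≤s (ℕ.s≤s ℕ.z≤n))) h
    eq : count (suc (suc t)) d ≡ 0ℚ
    eq = trans (cong (count (suc (suc t))) (sym (ℕ.m+[n∸m]≡n bound))) (count-support (suc (suc t)) (d ℕ.∸ (suc (suc t) ℕ.+ 2)))

  limit-large : ∀ t d → 2 ℕ.* t ℕ.≤ d → limit d * (q t + ½) ≤ 3ℚ
  limit-large t 0 _ = ≤-trans (≤-reflexive (*-zeroˡ (q t + ½))) (≤ᵇ⇒≤ tt)
  limit-large t 1 _ = ≤-trans (≤-reflexive (*-zeroˡ (q t + ½))) (≤ᵇ⇒≤ tt)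
  limit-large t (suc (suc k)) h = begin
    limit (2 ℕ.+ k) * (q t + ½)            ≤⟨ *-monoʳ-≤-nonNeg (q t + ½) {{nonNegative (0≤+ (0≤q t) (≤ᵇ⇒≤ tt))}} (proj₂ (limit-bounds k)) ⟩
    inv (1 ℕ.+ k) * (q t + ½)              ≡⟨ solve 2 (λ i a → i :* (a :+ con ½) := a :* i :+ con ½ :* i) refl (inv (1 ℕ.+ k)) (q t) ⟩
    q t * inv (1 ℕ.+ k) + ½ * inv (1 ℕ.+ k) ≤⟨ +-mono-≤ (q*inv≤1 (ℕ.≤-trans (ℕ.m≤m+n t (t ℕ.+ 0)) h)) (*-monoʳ ½ (≤ᵇ⇒≤ tt) (inv≤1 (1 ℕ.+ k))) ⟩
    1ℚ + ½ * 1ℚ                            ≤⟨ ≤ᵇ⇒≤ tt ⟩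
    3ℚ                                     ∎
    where open ≤-Reasoning

  deviation-large : ∀ t d → 2 ℕ.* t ℕ.≤ d → ∣ deviation t d ∣ ≤ 3ℚ
  deviation-large t d h = ∣p-q∣≤ (proj₁ (count-large t d h)) (proj₂ (count-large t d h))
    (0≤* (0≤limit d) (0≤+ (0≤q t) (≤ᵇ⇒≤ tt))) (limit-large t d h)

  -- Where both coefficients of `deviation-rec` are nonnegative, their sum is 1 - 1/(2 t + 1), so
  -- the bound 3 is inherited from the previous time.
  deviation-bound : ∀ t d → ∣ deviation t d ∣ ≤ 3ℚ
  deviation-bound zero d = deviation-large zero d ℕ.z≤n
  deviation-bound (suc t) zero = ≤-trans (≤-reflexive
    (cong ∣_∣ (solve 1 (λ a → con 0ℚ :- con 0ℚ :* a := con 0ℚ) refl (q (suc t) + ½)))) (≤ᵇ⇒≤ tt)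
  -- The coefficient 1 - (d + 1)/(2 t + 1) is nonnegative precisely for d + 1 ≤ 2 t + 1. Beyond
  -- that, d + 1 ≥ 2 (t + 1), which is what `deviation-large` requires at the later time.
  deviation-bound (suc t) (suc d) with suc d ℕ.≤? suc (2 ℕ.* t)
  ... | no  d> = deviation-large (suc t) (suc d) (subst (ℕ._≤ suc d) (sym (ℕ.*-suc 2 t)) (ℕ.≰⇒> d>))
  ... | yes d≤ = begin
    ∣ deviation (suc t) (suc d) ∣               ≡⟨ cong ∣_∣ (deviation-rec t d) ⟩
    ∣ α * u + β * v ∣                           ≤⟨ ∣p+q∣≤∣p∣+∣q∣ (α * u) (β * v) ⟩
    ∣ α * u ∣ + ∣ β * v ∣                       ≡⟨ cong₂ _+_ (∣p*q∣≡∣p∣*∣q∣ α u) (∣p*q∣≡∣p∣*∣q∣ β v) ⟩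
    ∣ α ∣ * ∣ u ∣ + ∣ β ∣ * ∣ v ∣               ≡⟨ cong₂ (λ x y → x * ∣ u ∣ + y * ∣ v ∣) (0≤p⇒∣p∣≡p 0≤α) (0≤p⇒∣p∣≡p 0≤β) ⟩
    α * ∣ u ∣ + β * ∣ v ∣                       ≤⟨ +-mono-≤ (*-monoʳ α 0≤α (deviation-bound t (suc d))) (*-monoʳ β 0≤β (deviation-bound t d)) ⟩
    α * 3ℚ + β * 3ℚ                             ≤⟨ +-monoʳ-≤ (α * 3ℚ) (*-monoʳ-≤-nonNeg 3ℚ
                                                     (*-monoʳ-≤-nonNeg (o t) {{nonNegative (0≤inv (2 ℕ.* t))}} (q-mono (ℕ.n≤1+n d)))) ⟩
    α * 3ℚ + q (suc d) * o t * 3ℚ               ≡⟨ solve 1 (λ x → (con 1ℚ :- x) :* con 3ℚ :+ x :* con 3ℚ := con 3ℚ) refl (q (suc d) * o t) ⟩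
    3ℚ                                          ∎
    where
    open ≤-Reasoning
    α = 1ℚ - q (suc d) * o t
    β = q d * o t
    u = deviation t (suc d)
    v = deviation t d
    0≤α : 0ℚ ≤ α
    0≤α = 0≤- (q*inv≤1 d≤)
    0≤β : 0ℚ ≤ β
    0≤β = 0≤* (0≤q d) (0≤inv (2 ℕ.* t))

  -- Evaluation of the limiting series and the error terms

  limitSum : ℕ → ℚ
  limitSum t = S (λ d → limit d * clustering d) (2 ℕ.+ t)

  -- The coefficients -18, 24 and -6 add up to zero, so the linear parts telescope under summation
  -- and only the squares accumulate.
  partial-fractions : ∀ k → limit (2 ℕ.+ k) * clustering (2 ℕ.+ k) ≡
    12ℚ * (inv (1 ℕ.+ k) * inv (1 ℕ.+ k)) - 18ℚ * inv (1 ℕ.+ k) + 24ℚ * inv (2 ℕ.+ k) - 6ℚ * inv (3 ℕ.+ k)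
  partial-fractions k = begin
    12ℚ * (x * y * z) * clustering (2 ℕ.+ k)
      ≡⟨ cong (12ℚ * (x * y * z) *_) (clustering-2+ k) ⟩
    12ℚ * (x * y * z) * (2ℚ * x)
      ≡⟨ solve 3 (λ x y z → con 12ℚ :* (x :* y :* z) :* (con 2ℚ :* x) := con 24ℚ :* (x :* x) :* (con 1ℚ :* (y :* z))) refl x y z ⟩
    24ℚ * (x * x) * (1ℚ * (y * z))
      ≡⟨ cong (24ℚ * (x * x) *_) yz ⟩
    24ℚ * (x * x) * (y - z)
      ≡⟨ solve 3 (λ x y z → con 24ℚ :* (x :* x) :* (y :- z) := con 24ℚ :* x :* (con 1ℚ :* (x :* y)) :- con 12ℚ :* x :* (con 2ℚ :* (x :* z))) refl x y z ⟩
    24ℚ * x * (1ℚ * (x * y)) - 12ℚ * x * (2ℚ * (x * z))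
      ≡⟨ cong₂ (λ a b → 24ℚ * x * a - 12ℚ * x * b) xy xz ⟩
    24ℚ * x * (x - y) - 12ℚ * x * (x - z)
      ≡⟨ solve 3 (λ x y z → con 24ℚ :* x :* (x :- y) :- con 12ℚ :* x :* (x :- z) :=
                   con 12ℚ :* (x :* x) :- con 24ℚ :* (con 1ℚ :* (x :* y)) :+ con 6ℚ :* (con 2ℚ :* (x :* z))) refl x y z ⟩
    12ℚ * (x * x) - 24ℚ * (1ℚ * (x * y)) + 6ℚ * (2ℚ * (x * z))
      ≡⟨ cong₂ (λ a b → 12ℚ * (x * x) - 24ℚ * a + 6ℚ * b) xy xz ⟩
    12ℚ * (x * x) - 24ℚ * (x - y) + 6ℚ * (x - z)
      ≡⟨ solve 3 (λ x y z → con 12ℚ :* (x :* x) :- con 24ℚ :* (x :- y) :+ con 6ℚ :* (x :- z) :=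
                   con 12ℚ :* (x :* x) :- con 18ℚ :* x :+ con 24ℚ :* y :- con 6ℚ :* z) refl x y z ⟩
    12ℚ * (x * x) - 18ℚ * x + 24ℚ * y - 6ℚ * z ∎
    where
    open ≡-Reasoning
    x = inv (1 ℕ.+ k)
    y = inv (2 ℕ.+ k)
    z = inv (3 ℕ.+ k)
    xy : 1ℚ * (x * y) ≡ x - y
    xy = trans (cong (_* (x * y)) (/1≡q 1)) (inv-diff 1 (1 ℕ.+ k))
    yz : 1ℚ * (y * z) ≡ y - z
    yz = trans (cong (_* (y * z)) (/1≡q 1)) (inv-diff 1 (2 ℕ.+ k))
    xz : 2ℚ * (x * z) ≡ x - z
    xz = trans (cong (_* (x * z)) (/1≡q 2)) (inv-diff 2 (1 ℕ.+ k))

  -- The constant 19 is dictated by the empty sum at t = 0: 12 - 19 + 18/2 - 6/3 = 0.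
  limitSum-closed : ∀ t → limitSum t ≡ 12ℚ * squares (suc t) - 19ℚ + (18ℚ * inv (1 ℕ.+ t) - 6ℚ * inv (2 ℕ.+ t))
  limitSum-closed zero = sym (trans
    (cong₂ (λ a b → 12ℚ * (0ℚ + a * a) - 19ℚ + b) inv-zero (cong₂ (λ a b → 18ℚ * a - 6ℚ * b) inv-1 inv-2)) refl)
  limitSum-closed (suc t) = begin
    limitSum t + limit (2 ℕ.+ t) * clustering (2 ℕ.+ t)
      ≡⟨ cong₂ _+_ (limitSum-closed t) (partial-fractions t) ⟩
    12ℚ * s - 19ℚ + (18ℚ * x - 6ℚ * y) + (12ℚ * (x * x) - 18ℚ * x + 24ℚ * y - 6ℚ * z)
      ≡⟨ solve 4 (λ s x y z → con 12ℚ :* s :- con 19ℚ :+ (con 18ℚ :* x :- con 6ℚ :* y)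
                   :+ (con 12ℚ :* (x :* x) :- con 18ℚ :* x :+ con 24ℚ :* y :- con 6ℚ :* z) :=
                   con 12ℚ :* (s :+ x :* x) :- con 19ℚ :+ (con 18ℚ :* y :- con 6ℚ :* z)) refl s x y z ⟩
    12ℚ * (s + x * x) - 19ℚ + (18ℚ * y - 6ℚ * z) ∎
    where
    open ≡-Reasoning
    s = squares (suc t)
    x = inv (1 ℕ.+ t)
    y = inv (2 ℕ.+ t)
    z = inv (3 ℕ.+ t)

  expected : ℕ → ℚ
  expected t = S (λ d → count t d * clustering d) (2 ℕ.+ t) * inv (1 ℕ.+ t)

  deviationSum : ℕ → ℚ
  deviationSum t = S (λ d → deviation t d * clustering d) (2 ℕ.+ t)

  -- The counts follow t + ½ while the average divides by the t + 2 vertices; the difference 3/2 is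
  -- the factor in front of `limitSum t`.
  expected-error : ∀ t → expected t - limitSum t ≡ (deviationSum t - (1ℚ + ½) * limitSum t) * inv (1 ℕ.+ t)
  expected-error t = trans (cong (λ x → x * i - limitSum t) split)
    (mod₁ (limitSum t) ((1ℚ + (1ℚ + a)) * i) (trans (cong (λ k → (1ℚ + k) * i) (sym (q-suc t))) (inv-eq (1 ℕ.+ t)))
      (solve 4 (λ a i s m → ((a :+ con ½) :* s :+ m) :* i :- s :- (m :- (con 1ℚ :+ con ½) :* s) :* i :=
                 s :* ((con 1ℚ :+ (con 1ℚ :+ a)) :* i :- con 1ℚ)) refl a i (limitSum t) (deviationSum t)))
    where
    a = q t
    i = inv (1 ℕ.+ t)
    split : S (λ d → count t d * clustering d) (2 ℕ.+ t) ≡ (a + ½) * limitSum t + deviationSum t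
    split = trans (S-cong (2 ℕ.+ t) (λ d _ → solve 4 (λ n p a c → n :* c := a :* (p :* c) :+ (n :- p :* a) :* c)
        refl (count t d) (limit d) (a + ½) (clustering d)))
      (trans (S-+ (λ d → (a + ½) * (limit d * clustering d)) (λ d → deviation t d * clustering d) (2 ℕ.+ t))
             (cong (_+ deviationSum t) (S-* (a + ½) (λ d → limit d * clustering d) (2 ℕ.+ t))))

  deviationSum-bound : ∀ t → ∣ deviationSum t ∣ ≤ 12ℚ * H (2 ℕ.+ t)
  deviationSum-bound t = begin
    ∣ deviationSum t ∣                                        ≤⟨ S-∣∣ (λ d → deviation t d * clustering d) (2 ℕ.+ t) ⟩
    S (λ d → ∣ deviation t d * clustering d ∣) (2 ℕ.+ t)      ≤⟨ S-mono (2 ℕ.+ t) (λ d _ → term d) ⟩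
    S (λ d → 12ℚ * inv d) (2 ℕ.+ t)                           ≡⟨ S-* 12ℚ inv (2 ℕ.+ t) ⟩
    12ℚ * H (2 ℕ.+ t)                                         ∎
    where
    open ≤-Reasoning
    term : ∀ d → ∣ deviation t d * clustering d ∣ ≤ 12ℚ * inv d
    term d = begin
      ∣ deviation t d * clustering d ∣      ≡⟨ ∣p*q∣≡∣p∣*∣q∣ (deviation t d) (clustering d) ⟩
      ∣ deviation t d ∣ * ∣ clustering d ∣  ≡⟨ cong (∣ deviation t d ∣ *_) (0≤p⇒∣p∣≡p (0≤clustering d)) ⟩
      ∣ deviation t d ∣ * clustering d      ≤⟨ *-mono-≤ (0≤clustering d) (≤ᵇ⇒≤ tt) (deviation-bound t d) (clustering≤ d) ⟩
      3ℚ * (4ℚ * inv d)                     ≡⟨ *-assoc 3ℚ 4ℚ (inv d) ⟨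
      12ℚ * inv d                           ∎

  limitSum-bound : ∀ t → ∣ limitSum t ∣ ≤ 4ℚ * H (2 ℕ.+ t)
  limitSum-bound t = begin
    ∣ limitSum t ∣                                            ≤⟨ S-∣∣ (λ d → limit d * clustering d) (2 ℕ.+ t) ⟩
    S (λ d → ∣ limit d * clustering d ∣) (2 ℕ.+ t)            ≤⟨ S-mono (2 ℕ.+ t) (λ d _ → term d) ⟩
    S (λ d → 4ℚ * inv d) (2 ℕ.+ t)                            ≡⟨ S-* 4ℚ inv (2 ℕ.+ t) ⟩
    4ℚ * H (2 ℕ.+ t)                                          ∎
    where
    open ≤-Reasoning
    term : ∀ d → ∣ limit d * clustering d ∣ ≤ 4ℚ * inv d
    term d = begin
      ∣ limit d * clustering d ∣      ≡⟨ 0≤p⇒∣p∣≡p (0≤* (0≤limit d) (0≤clustering d)) ⟩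
      limit d * clustering d          ≤⟨ *-mono-≤ (0≤clustering d) (≤ᵇ⇒≤ tt) (limit≤1 d) (clustering≤ d) ⟩
      1ℚ * (4ℚ * inv d)               ≡⟨ *-identityˡ (4ℚ * inv d) ⟩
      4ℚ * inv d                      ∎

  expected-limitSum : Null (λ t → expected t - limitSum t)
  -- 36 = 2 (12 + 3/2 · 4): the bounds on `deviationSum` and on 3/2 `limitSum`, doubled to move the
  -- reciprocal to the index of `H`.
  expected-limitSum = Null-≤ bound (Null-q* 36 (Null-suc (Null-suc Null-H)))
    where
    open ≤-Reasoning
    bound : ∀ t → ∣ expected t - limitSum t ∣ ≤ q 36 * (inv (2 ℕ.+ t) * H (2 ℕ.+ t))
    bound t = begin
      ∣ expected t - limitSum t ∣
        ≡⟨ cong ∣_∣ (expected-error t) ⟩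
      ∣ (deviationSum t - (1ℚ + ½) * limitSum t) * inv (1 ℕ.+ t) ∣
        ≡⟨ trans (∣p*q∣≡∣p∣*∣q∣ (deviationSum t - (1ℚ + ½) * limitSum t) (inv (1 ℕ.+ t))) (cong (∣ deviationSum t - (1ℚ + ½) * limitSum t ∣ *_) (0≤p⇒∣p∣≡p (0≤inv (1 ℕ.+ t)))) ⟩
      ∣ deviationSum t - (1ℚ + ½) * limitSum t ∣ * inv (1 ℕ.+ t)
        ≤⟨ *-mono-≤ (0≤inv (1 ℕ.+ t)) (0≤* {18ℚ} {H (2 ℕ.+ t)} (≤ᵇ⇒≤ tt) (0≤H (2 ℕ.+ t))) sum-bound (inv≤2inv (1 ℕ.+ t)) ⟩
      18ℚ * H (2 ℕ.+ t) * (2ℚ * inv (2 ℕ.+ t))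
        ≡⟨ solve 2 (λ h i → con 18ℚ :* h :* (con 2ℚ :* i) := con (+ 36 / 1) :* (i :* h)) refl (H (2 ℕ.+ t)) (inv (2 ℕ.+ t)) ⟩
      (+ 36 / 1) * (inv (2 ℕ.+ t) * H (2 ℕ.+ t))
        ≡⟨ cong (_* (inv (2 ℕ.+ t) * H (2 ℕ.+ t))) (/1≡q 36) ⟩
      q 36 * (inv (2 ℕ.+ t) * H (2 ℕ.+ t)) ∎
      where
      sum-bound : ∣ deviationSum t - (1ℚ + ½) * limitSum t ∣ ≤ 18ℚ * H (2 ℕ.+ t)
      sum-bound = begin
        ∣ deviationSum t - (1ℚ + ½) * limitSum t ∣            ≤⟨ ∣p-q∣≤∣p∣+∣q∣ (deviationSum t) ((1ℚ + ½) * limitSum t) ⟩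
        ∣ deviationSum t ∣ + ∣ (1ℚ + ½) * limitSum t ∣        ≡⟨ cong (_+_ ∣ deviationSum t ∣) (∣p*q∣≡∣p∣*∣q∣ (1ℚ + ½) (limitSum t)) ⟩
        ∣ deviationSum t ∣ + (1ℚ + ½) * ∣ limitSum t ∣        ≤⟨ +-mono-≤ (deviationSum-bound t) (*-monoʳ (1ℚ + ½) (≤ᵇ⇒≤ tt) (limitSum-bound t)) ⟩
        12ℚ * h + (1ℚ + ½) * (4ℚ * h)                         ≡⟨ solve 1 (λ h → con 12ℚ :* h :+ (con 1ℚ :+ con ½) :* (con 4ℚ :* h) := con 18ℚ :* h) refl h ⟩
        18ℚ * h                                               ∎
        where h = H (2 ℕ.+ t)

  -- The closed form contains `squares (suc t)`. Its last square is counted as an error, so that the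
  -- index agrees with that of `basel`.
  limitSum-squares : Null (λ t → limitSum t - (12ℚ * squares t - 19ℚ))
  limitSum-squares = Null-cong eq (Null-+ (Null-q* 12 (Null-≤ square-bound Null-inv))
    (Null-+ (Null-q* 18 (Null-suc Null-inv)) (Null-neg (Null-q* 6 (Null-suc (Null-suc Null-inv))))))
    where
    square-bound : ∀ n → ∣ inv n * inv n ∣ ≤ inv n
    square-bound n = ≤-trans (≤-reflexive (0≤p⇒∣p∣≡p (0≤* (0≤inv n) (0≤inv n))))
      (≤-trans (*-monoʳ (inv n) (0≤inv n) (inv≤1 n)) (≤-reflexive (*-identityʳ (inv n))))
    eq : ∀ t → q 12 * (inv t * inv t) + (q 18 * inv (1 ℕ.+ t) + - (q 6 * inv (2 ℕ.+ t))) ≡ limitSum t - (12ℚ * squares t - 19ℚ)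
    eq t = begin
      q 12 * (x * x) + (q 18 * y + - (q 6 * z))
        ≡⟨ cong₂ (λ a b → a * (x * x) + (b * y + - (q 6 * z))) (sym (/1≡q 12)) (sym (/1≡q 18)) ⟩
      12ℚ * (x * x) + (18ℚ * y + - (q 6 * z))
        ≡⟨ cong (λ a → 12ℚ * (x * x) + (18ℚ * y + - (a * z))) (sym (/1≡q 6)) ⟩
      12ℚ * (x * x) + (18ℚ * y + - (6ℚ * z))
        ≡⟨ solve 4 (λ s x y z → con 12ℚ :* (x :* x) :+ (con 18ℚ :* y :+ :- (con 6ℚ :* z)) :=
             con 12ℚ :* (s :+ x :* x) :- con 19ℚ :+ (con 18ℚ :* y :- con 6ℚ :* z) :- (con 12ℚ :* s :- con 19ℚ)) refl (squares t) x y z ⟩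
      12ℚ * (squares t + x * x) - 19ℚ + (18ℚ * y - 6ℚ * z) - (12ℚ * squares t - 19ℚ)
        ≡⟨ cong (_- (12ℚ * squares t - 19ℚ)) (limitSum-closed t) ⟨
      limitSum t - (12ℚ * squares t - 19ℚ) ∎
      where
      open ≡-Reasoning
      x = inv t
      y = inv (1 ℕ.+ t)
      z = inv (2 ℕ.+ t)

  expected-limit : Null (λ t → expected t - ((+ 32 / 1) * (leibnizSum t * leibnizSum t) - 19ℚ))
  expected-limit = Null-cong (λ t → solve 4 (λ e l s p → (e :- l) :+ ((l :- (con 12ℚ :* s :- con 19ℚ)) :+ (con 12ℚ :* s :- con (+ 32 / 1) :* p))
        := e :- (con (+ 32 / 1) :* p :- con 19ℚ)) refl (expected t) (limitSum t) (squares t) (leibnizSum t * leibnizSum t))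
    (Null-+ expected-limitSum (Null-+ limitSum-squares basel))

-- Degrees and triangles when a vertex is attached

module Graphs where

  open import Defs using (Edge; edge; end₁; end₂; Graph; edges; unique; Joins; Adjacent; adjacent?; degree; edgesAmongNeighbours)
  open import Defs using (singleEdge; attach; oldEdge; newEdge; newEdge-distinct)

  indicator : ∀ {P : Set} → Dec P → ℕ
  indicator (yes _) = 1
  indicator (no  _) = 0

  indicator-cong : ∀ {P Q : Set} (p : Dec P) (r : Dec Q) → (P → Q) → (Q → P) → indicator p ≡ indicator r
  indicator-cong (yes p) (yes r) f g = refl
  indicator-cong (yes p) (no ¬r) f g = ⊥-elim (¬r (f p))
  indicator-cong (no ¬p) (yes r) f g = ⊥-elim (¬p (g r))
  indicator-cong (no ¬p) (no ¬r) f g = refl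

  indicator-yes : ∀ {P : Set} (p : Dec P) → P → indicator p ≡ 1
  indicator-yes (yes _) x = refl
  indicator-yes (no ¬x) x = ⊥-elim (¬x x)

  indicator-no : ∀ {P : Set} (p : Dec P) → ¬ P → indicator p ≡ 0
  indicator-no (yes x) ¬x = ⊥-elim (¬x x)
  indicator-no (no _)  ¬x = refl

  indicator-⊎ : ∀ {P Q : Set} (p : Dec P) (r : Dec Q) → (P → ¬ Q) →
                indicator (p ⊎-dec r) ≡ indicator p ℕ.+ indicator r
  indicator-⊎ (yes x) (yes y) disjoint = ⊥-elim (disjoint x y)
  indicator-⊎ (yes x) (no _)  disjoint = refl
  indicator-⊎ (no _) (yes y) disjoint = refl
  indicator-⊎ (no _) (no _) disjoint = refl

  module _ {A : Set} where

    # : {P : A → Set} → Decidable P → List A → ℕ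
    # P? xs = length (filter P? xs)

    #-∷ : ∀ {P : A → Set} (P? : Decidable P) x xs → # P? (x ∷ xs) ≡ indicator (P? x) ℕ.+ # P? xs
    #-∷ P? x xs with P? x
    ... | yes _ = refl
    ... | no  _ = refl

    #-cong : ∀ {P Q : A → Set} (P? : Decidable P) (Q? : Decidable Q) →
             (∀ x → P x → Q x) → (∀ x → Q x → P x) → ∀ xs → # P? xs ≡ # Q? xs
    #-cong P? Q? f g []       = refl
    #-cong P? Q? f g (x ∷ xs) = trans (#-∷ P? x xs) (trans
      (cong₂ ℕ._+_ (indicator-cong (P? x) (Q? x) (f x) (g x)) (#-cong P? Q? f g xs)) (sym (#-∷ Q? x xs)))

    #-none : ∀ {P : A → Set} (P? : Decidable P) {xs} → All (¬_ ∘ P) xs → # P? xs ≡ 0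
    #-none P? []           = refl
    #-none P? (¬px ∷ ¬pxs) = trans (#-∷ P? _ _) (cong₂ ℕ._+_ (indicator-no (P? _) ¬px) (#-none P? ¬pxs))

    #-⊎ : ∀ {P Q : A → Set} (P? : Decidable P) (Q? : Decidable Q) → (∀ x → P x → ¬ Q x) →
          ∀ xs → # (λ x → P? x ⊎-dec Q? x) xs ≡ # P? xs ℕ.+ # Q? xs
    #-⊎ P? Q? disjoint []       = refl
    #-⊎ P? Q? disjoint (x ∷ xs) = begin
      # PQ? (x ∷ xs)                                                      ≡⟨ #-∷ PQ? x xs ⟩
      indicator (PQ? x) ℕ.+ # PQ? xs                                      ≡⟨ cong₂ ℕ._+_ (indicator-⊎ (P? x) (Q? x) (disjoint x)) (#-⊎ P? Q? disjoint xs) ⟩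
      (indicator (P? x) ℕ.+ indicator (Q? x)) ℕ.+ (# P? xs ℕ.+ # Q? xs)   ≡⟨ interchange (indicator (P? x)) (indicator (Q? x)) (# P? xs) (# Q? xs) ⟩
      (indicator (P? x) ℕ.+ # P? xs) ℕ.+ (indicator (Q? x) ℕ.+ # Q? xs)   ≡⟨ cong₂ ℕ._+_ (#-∷ P? x xs) (#-∷ Q? x xs) ⟨
      # P? (x ∷ xs) ℕ.+ # Q? (x ∷ xs)                                     ∎
      where
      open ≡-Reasoning
      open import Algebra.Properties.CommutativeSemigroup ℕ.+-commutativeSemigroup using (interchange)
      PQ? = λ x → P? x ⊎-dec Q? x

    #-unique : ∀ {P : A → Set} (P? : Decidable P) {x} → P x → (∀ y → P y → x ≡ y) →
               ∀ {xs} → Unique xs → x ∈ xs → # P? xs ≡ 1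
    #-unique P? px only {y ∷ ys} (y∉ys ∷ u) (here refl) = trans (#-∷ P? y ys)
      (cong₂ ℕ._+_ (indicator-yes (P? y) px) (#-none P? (All.map (λ y≢z pz → y≢z (only _ pz)) y∉ys)))
    #-unique P? {x} px only {y ∷ ys} (y∉ys ∷ u) (there x∈) = trans (#-∷ P? y ys)
      (cong₂ ℕ._+_ (indicator-no (P? y) (λ py → All.lookup y∉ys x∈ (sym (only y py)))) (#-unique P? px only u x∈))

  #-map : ∀ {A B : Set} {P : B → Set} (P? : Decidable P) (f : A → B) xs → # P? (map f xs) ≡ # (P? ∘ f) xs
  #-map P? f []       = refl
  #-map P? f (x ∷ xs) = trans (#-∷ P? (f x) (map f xs))
    (trans (cong (ℕ._+_ (indicator (P? (f x)))) (#-map P? f xs)) (sym (#-∷ (P? ∘ f) x xs)))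

  tabulate-suc : ∀ {A : Set} {n} (f : Fin (suc n) → A) → tabulate f ≡ tabulate (f ∘ inject₁) ++ (f (fromℕ n) ∷ [])
  tabulate-suc {n = zero}  f = refl
  tabulate-suc {n = suc n} f = cong (f Fin.zero ∷_) (tabulate-suc (f ∘ Fin.suc))

  allFin-suc : ∀ n → allFin (suc n) ≡ map inject₁ (allFin n) ++ (fromℕ n ∷ [])
  allFin-suc n = trans (tabulate-suc (λ i → i)) (cong (_++ (fromℕ n ∷ [])) (sym (List.map-tabulate (λ i → i) inject₁)))

  #-allFin-suc : ∀ {n} {P : Fin (suc n) → Set} (P? : Decidable P) →
                 # P? (allFin (suc n)) ≡ # (P? ∘ inject₁) (allFin n) ℕ.+ indicator (P? (fromℕ n))
  #-allFin-suc {n} P? = begin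
    # P? (allFin (suc n))                                            ≡⟨ cong (# P?) (allFin-suc n) ⟩
    # P? (map inject₁ (allFin n) ++ (fromℕ n ∷ []))                  ≡⟨ cong length (List.filter-++ P? (map inject₁ (allFin n)) (fromℕ n ∷ [])) ⟩
    length (filter P? (map inject₁ (allFin n)) ++ filter P? (fromℕ n ∷ [])) ≡⟨ List.length-++ (filter P? (map inject₁ (allFin n))) ⟩
    # P? (map inject₁ (allFin n)) ℕ.+ # P? (fromℕ n ∷ [])            ≡⟨ cong₂ ℕ._+_ (#-map P? inject₁ (allFin n)) (trans (#-∷ P? (fromℕ n) []) (ℕ.+-identityʳ _)) ⟩
    # (P? ∘ inject₁) (allFin n) ℕ.+ indicator (P? (fromℕ n))         ∎
    where open ≡-Reasoning

  End : ∀ {n} → Edge n → Fin n → Set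
  End e i = i ≡ end₁ e ⊎ i ≡ end₂ e

  end? : ∀ {n} (e : Edge n) → Decidable (End e)
  end? e i = (i Fin.≟ end₁ e) ⊎-dec (i Fin.≟ end₂ e)

  -- A uniformly chosen edge hits i in proportion to the listed edges ending at i, whereas `degree`
  -- counts neighbouring vertices. The two are kept apart and shown equal along the process.
  incidence : ∀ {n} → Graph n → Fin n → ℕ
  incidence G i = # (λ e → end? e i) (toList (edges G))

  ends-distinct : ∀ {n} (e : Edge n) → end₁ e ≢ end₂ e
  ends-distinct e eq = newEdge-distinct e (cong newEdge eq)

  ¬loop : ∀ {n} (G : Graph n) i → ¬ Adjacent G i i
  ¬loop G i adj with Any.satisfied adj
  ... | e , inj₁ (p , r) = ends-distinct e (trans (sym p) r)
  ... | e , inj₂ (p , r) = ends-distinct e (trans (sym r) p)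

  edge-≡ : ∀ {n} {e f : Edge n} → end₁ e ≡ end₁ f → end₂ e ≡ end₂ f → e ≡ f
  edge-≡ {e = edge _ _ _} {edge _ _ _} refl refl = refl

  absurd : ∀ {A : Set} → .⊥ → A
  absurd ()

  -- The ends of an edge are ordered, so they determine the edge.
  ends-determine : ∀ {n} (e f : Edge n) → End e (end₁ f) → End e (end₂ f) → e ≡ f
  ends-determine e f (inj₁ p) (inj₁ r) = ⊥-elim (ends-distinct f (trans p (sym r)))
  ends-determine e f (inj₁ p) (inj₂ r) = edge-≡ (sym p) (sym r)
  ends-determine (edge u w u<w) (edge u′ w′ u′<w′) (inj₂ refl) (inj₁ refl) = absurd (ℕ.<-asym u<w u′<w′)
  ends-determine e f (inj₂ p) (inj₂ r) = ⊥-elim (ends-distinct f (trans p (sym r)))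

  ≢new : ∀ {n} {i : Fin n} → inject₁ i ≢ fromℕ n
  ≢new = Fin.fromℕ≢inject₁ ∘ sym

  module Attach {n} (G : Graph n) (e : Edge n) where

    G′ : Graph (suc n)
    G′ = attach G e

    new : Fin (suc n)
    new = fromℕ n

    es : List (Edge n)
    es = toList (edges G)

    old→ : ∀ {i j} → Adjacent G i j → Adjacent G′ (inject₁ i) (inject₁ j)
    old→ {i} {j} adj = there (there (Any.map⁺ {f = oldEdge} (Any.map (λ {f} → lift f) adj)))
      where
      lift : ∀ f → Joins i j f → Joins (inject₁ i) (inject₁ j) (oldEdge f)
      lift (edge _ _ _) (inj₁ (p , r)) = inj₁ (cong inject₁ p , cong inject₁ r)
      lift (edge _ _ _) (inj₂ (p , r)) = inj₂ (cong inject₁ p , cong inject₁ r)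

    →old : ∀ {i j} → Adjacent G′ (inject₁ i) (inject₁ j) → Adjacent G i j
    →old (here (inj₁ (p , r)))         = ⊥-elim (≢new r)
    →old (here (inj₂ (p , r)))         = ⊥-elim (≢new p)
    →old (there (here (inj₁ (p , r)))) = ⊥-elim (≢new r)
    →old (there (here (inj₂ (p , r)))) = ⊥-elim (≢new p)
    →old {i} {j} (there (there adj))   = Any.map (λ {f} → lower f) (Any.map⁻ {f = oldEdge} {xs = es} adj)
      where
      lower : ∀ f → Joins (inject₁ i) (inject₁ j) (oldEdge f) → Joins i j f
      lower (edge _ _ _) (inj₁ (p , r)) = inj₁ (Fin.inject₁-injective p , Fin.inject₁-injective r)
      lower (edge _ _ _) (inj₂ (p , r)) = inj₂ (Fin.inject₁-injective p , Fin.inject₁-injective r)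

    ¬new-old : ∀ {j} → ¬ Any (Joins new j) (map oldEdge es)
    ¬new-old {j} adj with Any.satisfied (Any.map⁻ {f = oldEdge} {xs = es} adj)
    ... | edge _ _ _ , inj₁ (p , r) = ≢new (sym p)
    ... | edge _ _ _ , inj₂ (p , r) = ≢new (sym p)

    new→ : ∀ {i} → Adjacent G′ new (inject₁ i) → End e i
    new→ (here (inj₁ (p , r)))         = ⊥-elim (≢new r)
    new→ (here (inj₂ (p , r)))         = inj₁ (Fin.inject₁-injective r)
    new→ (there (here (inj₁ (p , r)))) = ⊥-elim (≢new r)
    new→ (there (here (inj₂ (p , r)))) = inj₂ (Fin.inject₁-injective r)
    new→ (there (there adj))           = ⊥-elim (¬new-old adj)

    →new : ∀ {i} → End e i → Adjacent G′ new (inject₁ i)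
    →new (inj₁ refl) = here (inj₂ (refl , refl))
    →new (inj₂ refl) = there (here (inj₂ (refl , refl)))

    adjacent-sym : ∀ {m} (K : Graph m) {i j} → Adjacent K i j → Adjacent K j i
    adjacent-sym K = Any.map λ { (inj₁ (p , r)) → inj₂ (r , p) ; (inj₂ (p , r)) → inj₁ (r , p) }

    degree-old : ∀ i → degree G′ (inject₁ i) ≡ indicator (end? e i) ℕ.+ degree G i
    degree-old i = begin
      degree G′ (inject₁ i)
        ≡⟨ #-allFin-suc (adjacent? G′ (inject₁ i)) ⟩
      # (adjacent? G′ (inject₁ i) ∘ inject₁) (allFin n) ℕ.+ indicator (adjacent? G′ (inject₁ i) new)
        ≡⟨ cong₂ ℕ._+_ (#-cong (adjacent? G′ (inject₁ i) ∘ inject₁) (adjacent? G i) (λ _ → →old) (λ _ → old→) (allFin n))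
                       (indicator-cong (adjacent? G′ (inject₁ i) new) (end? e i) (new→ ∘ adjacent-sym G′) (adjacent-sym G′ ∘ →new)) ⟩
      degree G i ℕ.+ indicator (end? e i)
        ≡⟨ ℕ.+-comm (degree G i) (indicator (end? e i)) ⟩
      indicator (end? e i) ℕ.+ degree G i ∎
      where open ≡-Reasoning

    degree-new : degree G′ new ≡ 2
    degree-new = begin
      degree G′ new
        ≡⟨ #-allFin-suc (adjacent? G′ new) ⟩
      # (adjacent? G′ new ∘ inject₁) (allFin n) ℕ.+ indicator (adjacent? G′ new new)
        ≡⟨ cong₂ ℕ._+_ (#-cong (adjacent? G′ new ∘ inject₁) (end? e) (λ _ → new→) (λ _ → →new) (allFin n)) (indicator-no (adjacent? G′ new new) (¬loop G′ new)) ⟩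
      # (end? e) (allFin n) ℕ.+ 0
        ≡⟨ ℕ.+-identityʳ _ ⟩
      # (end? e) (allFin n)
        ≡⟨ #-⊎ (Fin._≟ end₁ e) (Fin._≟ end₂ e) (λ i p r → ends-distinct e (trans (sym p) r)) (allFin n) ⟩
      # (Fin._≟ end₁ e) (allFin n) ℕ.+ # (Fin._≟ end₂ e) (allFin n)
        ≡⟨ cong₂ ℕ._+_ (#-unique (Fin._≟ end₁ e) refl (λ _ → sym) (Unique.allFin⁺ n) (∈-allFin (end₁ e)))
                       (#-unique (Fin._≟ end₂ e) refl (λ _ → sym) (Unique.allFin⁺ n) (∈-allFin (end₂ e))) ⟩
      2 ∎
      where open ≡-Reasoning

    #-edges : ∀ {P : Edge (suc n) → Set} (P? : Decidable P) → # P? (toList (edges G′)) ≡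
              indicator (P? (newEdge (end₁ e))) ℕ.+ (indicator (P? (newEdge (end₂ e))) ℕ.+ # (P? ∘ oldEdge) es)
    #-edges P? = trans (#-∷ P? (newEdge (end₁ e)) _) (cong (ℕ._+_ (indicator (P? (newEdge (end₁ e)))))
      (trans (#-∷ P? (newEdge (end₂ e)) _) (cong (ℕ._+_ (indicator (P? (newEdge (end₂ e))))) (#-map P? oldEdge es))))

    incidence-old : ∀ i → incidence G′ (inject₁ i) ≡ indicator (end? e i) ℕ.+ incidence G i
    incidence-old i = begin
      incidence G′ (inject₁ i)
        ≡⟨ #-edges (λ f → end? f (inject₁ i)) ⟩
      indicator (end? (newEdge (end₁ e)) (inject₁ i)) ℕ.+ (indicator (end? (newEdge (end₂ e)) (inject₁ i)) ℕ.+ # (λ f → end? (oldEdge f) (inject₁ i)) es)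
        ≡⟨ cong₂ ℕ._+_ (at-new (end₁ e)) (cong₂ ℕ._+_ (at-new (end₂ e))
             (#-cong (λ f → end? (oldEdge f) (inject₁ i)) (λ f → end? f i) lower lift es)) ⟩
      indicator (i Fin.≟ end₁ e) ℕ.+ (indicator (i Fin.≟ end₂ e) ℕ.+ incidence G i)
        ≡⟨ ℕ.+-assoc (indicator (i Fin.≟ end₁ e)) _ _ ⟨
      indicator (i Fin.≟ end₁ e) ℕ.+ indicator (i Fin.≟ end₂ e) ℕ.+ incidence G i
        ≡⟨ cong (ℕ._+ incidence G i) (indicator-⊎ (i Fin.≟ end₁ e) (i Fin.≟ end₂ e) (λ p r → ends-distinct e (trans (sym p) r))) ⟨
      indicator (end? e i) ℕ.+ incidence G i ∎
      where
      open ≡-Reasoning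
      at-new : ∀ u → indicator (end? (newEdge u) (inject₁ i)) ≡ indicator (i Fin.≟ u)
      at-new u = indicator-cong (end? (newEdge u) (inject₁ i)) (i Fin.≟ u) [ Fin.inject₁-injective , ⊥-elim ∘ ≢new ]′ (λ p → inj₁ (cong inject₁ p))
      lower : ∀ f → End (oldEdge f) (inject₁ i) → End f i
      lower (edge _ _ _) (inj₁ p) = inj₁ (Fin.inject₁-injective p)
      lower (edge _ _ _) (inj₂ p) = inj₂ (Fin.inject₁-injective p)
      lift : ∀ f → End f i → End (oldEdge f) (inject₁ i)
      lift (edge _ _ _) (inj₁ p) = inj₁ (cong inject₁ p)
      lift (edge _ _ _) (inj₂ p) = inj₂ (cong inject₁ p)

    incidence-new : incidence G′ new ≡ 2
    incidence-new = trans (#-edges (λ f → end? f new)) (cong₂ ℕ._+_ (indicator-yes (end? (newEdge (end₁ e)) new) (inj₂ refl)) (cong₂ ℕ._+_ (indicator-yes (end? (newEdge (end₂ e)) new) (inj₂ refl))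
      (#-none (λ f → end? (oldEdge f) new) (All.universal not-old es))))
      where
      not-old : ∀ f → ¬ End (oldEdge f) new
      not-old (edge _ _ _) (inj₁ p) = ≢new (sym p)
      not-old (edge _ _ _) (inj₂ p) = ≢new (sym p)

    among? : ∀ {m} (K : Graph m) i → Decidable (λ f → Adjacent K i (end₁ f) × Adjacent K i (end₂ f))
    among? K i f = adjacent? K i (end₁ f) ×-dec adjacent? K i (end₂ f)

    module _ (e∈G : e ∈ es) where

      private
        u w : Fin n
        u = end₁ e
        w = end₂ e

      u~w : Adjacent G u w
      u~w = Any.map (λ { refl → inj₁ (refl , refl) }) e∈G

      -- The new vertex closes exactly one triangle at each end of e, through the other end.
      edgesAmong-old : ∀ i → edgesAmongNeighbours G′ (inject₁ i) ≡ indicator (end? e i) ℕ.+ edgesAmongNeighbours G i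
      edgesAmong-old i = begin
        edgesAmongNeighbours G′ (inject₁ i)
          ≡⟨ #-edges (among? G′ (inject₁ i)) ⟩
        indicator (among? G′ (inject₁ i) (newEdge u)) ℕ.+ (indicator (among? G′ (inject₁ i) (newEdge w)) ℕ.+ # (among? G′ (inject₁ i) ∘ oldEdge) es)
          ≡⟨ cong₂ ℕ._+_ (indicator-cong (among? G′ (inject₁ i) (newEdge u)) (i Fin.≟ w) at-u from-w) (cong₂ ℕ._+_ (indicator-cong (among? G′ (inject₁ i) (newEdge w)) (i Fin.≟ u) at-w from-u)
               (#-cong (among? G′ (inject₁ i) ∘ oldEdge) (among? G i) lower lift es)) ⟩
        indicator (i Fin.≟ w) ℕ.+ (indicator (i Fin.≟ u) ℕ.+ edgesAmongNeighbours G i)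
          ≡⟨ ℕ.+-assoc (indicator (i Fin.≟ w)) _ _ ⟨
        indicator (i Fin.≟ w) ℕ.+ indicator (i Fin.≟ u) ℕ.+ edgesAmongNeighbours G i
          ≡⟨ cong (ℕ._+ edgesAmongNeighbours G i) (trans (ℕ.+-comm (indicator (i Fin.≟ w)) _)
               (sym (indicator-⊎ (i Fin.≟ end₁ e) (i Fin.≟ end₂ e) (λ p r → ends-distinct e (trans (sym p) r))))) ⟩
        indicator (end? e i) ℕ.+ edgesAmongNeighbours G i ∎
        where
        open ≡-Reasoning
        at-u : Adjacent G′ (inject₁ i) (inject₁ u) × Adjacent G′ (inject₁ i) new → i ≡ w
        at-u (i~u , i~v) with new→ (adjacent-sym G′ i~v)
        ... | inj₁ refl = ⊥-elim (¬loop G u (→old i~u))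
        ... | inj₂ p    = p
        at-w : Adjacent G′ (inject₁ i) (inject₁ w) × Adjacent G′ (inject₁ i) new → i ≡ u
        at-w (i~w , i~v) with new→ (adjacent-sym G′ i~v)
        ... | inj₁ p    = p
        ... | inj₂ refl = ⊥-elim (¬loop G w (→old i~w))
        from-w : i ≡ w → Adjacent G′ (inject₁ i) (inject₁ u) × Adjacent G′ (inject₁ i) new
        from-w refl = old→ (adjacent-sym G u~w) , adjacent-sym G′ (→new (inj₂ refl))
        from-u : i ≡ u → Adjacent G′ (inject₁ i) (inject₁ w) × Adjacent G′ (inject₁ i) new
        from-u refl = old→ u~w , adjacent-sym G′ (→new (inj₁ refl))
        lower : ∀ f → Adjacent G′ (inject₁ i) (end₁ (oldEdge f)) × Adjacent G′ (inject₁ i) (end₂ (oldEdge f)) →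
                Adjacent G i (end₁ f) × Adjacent G i (end₂ f)
        lower (edge _ _ _) (p , r) = →old p , →old r
        lift : ∀ f → Adjacent G i (end₁ f) × Adjacent G i (end₂ f) →
               Adjacent G′ (inject₁ i) (end₁ (oldEdge f)) × Adjacent G′ (inject₁ i) (end₂ (oldEdge f))
        lift (edge _ _ _) (p , r) = old→ p , old→ r

      -- The neighbours of the new vertex are the ends of e, and e is the only edge joining them;
      -- `unique G` makes it occur once. Both new edges end in the new vertex, which is not its own
      -- neighbour.
      edgesAmong-new : edgesAmongNeighbours G′ new ≡ 1
      edgesAmong-new = trans (#-edges (among? G′ new)) (cong₂ ℕ._+_ (indicator-no (among? G′ new (newEdge u)) (¬loop G′ new ∘ proj₂)) (cong₂ ℕ._+_ (indicator-no (among? G′ new (newEdge w)) (¬loop G′ new ∘ proj₂))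
        (#-unique (among? G′ new ∘ oldEdge) (lift e (inj₁ refl) (inj₂ refl)) only (unique G) e∈G)))
        where
        lift : ∀ f → End e (end₁ f) → End e (end₂ f) → Adjacent G′ new (end₁ (oldEdge f)) × Adjacent G′ new (end₂ (oldEdge f))
        lift (edge _ _ _) p r = →new p , →new r
        only : ∀ f → Adjacent G′ new (end₁ (oldEdge f)) × Adjacent G′ new (end₂ (oldEdge f)) → e ≡ f
        only f@(edge _ _ _) (p , r) = ends-determine e f (new→ p) (new→ r)

  -- What an expectation needs from each graph in the support: the edge count gives the probability
  -- 1/(2 t + 1) of an edge, the incidence the chance of hitting a vertex, and the last field makes
  -- clustering a function of the degree alone.
  record Invariant (t : ℕ) (G : Graph (2 ℕ.+ t)) : Set where
    field
      edgeCount     : length (toList (edges G)) ≡ suc (2 ℕ.* t)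
      incidence≡deg : ∀ i → incidence G i ≡ degree G i
      degree≡suc    : ∀ i → degree G i ≡ suc (edgesAmongNeighbours G i)

  open Invariant public

  invariant-singleEdge : Invariant 0 singleEdge
  invariant-singleEdge = record
    { edgeCount     = refl
    ; incidence≡deg = λ { Fin.zero → refl ; (Fin.suc Fin.zero) → refl }
    ; degree≡suc    = λ { Fin.zero → refl ; (Fin.suc Fin.zero) → refl }
    }

  fromℕ-or-inject₁ : ∀ {n} (P : Fin (suc n) → Set) → P (fromℕ n) → (∀ i → P (inject₁ i)) → ∀ i → P i
  fromℕ-or-inject₁ {zero}  P pn pi Fin.zero    = pn
  fromℕ-or-inject₁ {suc n} P pn pi Fin.zero    = pi Fin.zero
  fromℕ-or-inject₁ {suc n} P pn pi (Fin.suc i) = fromℕ-or-inject₁ (P ∘ Fin.suc) pn (pi ∘ Fin.suc) i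

  -- At an old vertex degree, incidence and number of edges among the neighbours all grow by the
  -- same indicator of being an end of e. At the new vertex they are 2, 2 and 1.
  invariant-attach : ∀ {t} {G : Graph (2 ℕ.+ t)} → Invariant t G → ∀ {e} → e ∈ toList (edges G) → Invariant (suc t) (attach G e)
  invariant-attach {t} {G} inv {e} e∈G = record
    { edgeCount     = cong (suc ∘ suc) (trans (List.length-map oldEdge es) (trans (edgeCount inv) (sym (ℕ.+-suc t (t ℕ.+ 0)))))
    ; incidence≡deg = fromℕ-or-inject₁ _ (trans incidence-new (sym degree-new)) λ i →
        trans (incidence-old i) (trans (cong (ℕ._+_ (indicator (end? e i))) (incidence≡deg inv i)) (sym (degree-old i)))
    ; degree≡suc    = fromℕ-or-inject₁ _ (trans degree-new (cong suc (sym (edgesAmong-new e∈G)))) λ i →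
        trans (degree-old i) (trans (cong (ℕ._+_ (indicator (end? e i))) (degree≡suc inv i))
          (trans (ℕ.+-suc (indicator (end? e i)) _) (cong suc (sym (edgesAmong-old e∈G i)))))
    }
    where open Attach G e

-- Expectations of degree sums over the process

module Expectation where

  open import Data.Rational
  open import Data.Rational.Properties
  open +-*-Solver using (solve; _:+_; _:*_; _:-_; :-_; _:=_; con)
  open import Defs using (Graph; edges; degree; localClustering; averageClustering; clusteringFormula)
  open import Defs using (∑; Dist; return; _>>=_; uniform; 𝔼; attach; singleEdge; process)
  open Rationals
  open Basel using (o; 2ℚ)
  open DegreeLaw
  open Graphs

  module _ {A : Set} where

    ∑-cong : ∀ {f g : A → ℚ} {xs} → All (λ x → f x ≡ g x) xs → ∑ f xs ≡ ∑ g xs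
    ∑-cong []       = refl
    ∑-cong (p ∷ ps) = cong₂ _+_ p (∑-cong ps)

    ∑-++ : ∀ (f : A → ℚ) xs ys → ∑ f (xs ++ ys) ≡ ∑ f xs + ∑ f ys
    ∑-++ f []       ys = sym (+-identityˡ (∑ f ys))
    ∑-++ f (x ∷ xs) ys = trans (cong (_+_ (f x)) (∑-++ f xs ys)) (sym (+-assoc (f x) (∑ f xs) (∑ f ys)))

    ∑-+ : ∀ (f g : A → ℚ) xs → ∑ (λ x → f x + g x) xs ≡ ∑ f xs + ∑ g xs
    ∑-+ f g []       = refl
    ∑-+ f g (x ∷ xs) = trans (cong (_+_ (f x + g x)) (∑-+ f g xs))
      (solve 4 (λ a b c d → a :+ b :+ (c :+ d) := a :+ c :+ (b :+ d)) refl (f x) (g x) (∑ f xs) (∑ g xs))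

    ∑-* : ∀ c (f : A → ℚ) xs → ∑ (λ x → c * f x) xs ≡ c * ∑ f xs
    ∑-* c f []       = sym (*-zeroʳ c)
    ∑-* c f (x ∷ xs) = trans (cong (_+_ (c * f x)) (∑-* c f xs)) (sym (*-distribˡ-+ c (f x) (∑ f xs)))

    ∑-const : ∀ c (xs : List A) → ∑ (λ _ → c) xs ≡ q (length xs) * c
    ∑-const c []       = sym (trans (cong (_* c) q-zero) (*-zeroˡ c))
    ∑-const c (x ∷ xs) = trans (cong (_+_ c) (∑-const c xs))
      (trans (solve 2 (λ c n → c :+ n :* c := (con 1ℚ :+ n) :* c) refl c (q (length xs)))
             (cong (_* c) (sym (q-suc (length xs)))))

    ∑-indicator : ∀ {P : A → Set} (P? : Decidable P) xs → ∑ (λ x → q (indicator (P? x))) xs ≡ q (# P? xs)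
    ∑-indicator P? []       = sym q-zero
    ∑-indicator P? (x ∷ xs) = trans (cong (_+_ (q (indicator (P? x)))) (∑-indicator P? xs))
      (trans (sym (q-+ (indicator (P? x)) (# P? xs))) (cong q (sym (#-∷ P? x xs))))

  ∑-map : ∀ {A B : Set} (f : B → ℚ) (g : A → B) xs → ∑ f (map g xs) ≡ ∑ (f ∘ g) xs
  ∑-map f g []       = refl
  ∑-map f g (x ∷ xs) = cong (_+_ (f (g x))) (∑-map f g xs)

  ∑-swap : ∀ {A B : Set} (f : A → B → ℚ) xs ys → ∑ (λ x → ∑ (f x) ys) xs ≡ ∑ (λ y → ∑ (λ x → f x y) xs) ys
  ∑-swap f []       ys = sym (trans (∑-const 0ℚ ys) (*-zeroʳ (q (length ys))))
  ∑-swap f (x ∷ xs) ys = trans (cong (_+_ (∑ (f x) ys)) (∑-swap f xs ys)) (sym (∑-+ (f x) (λ y → ∑ (λ x → f x y) xs) ys))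

  module _ {A : Set} where

    𝔼-cong : ∀ {f g : A → ℚ} {μ} → All (λ (x , _) → f x ≡ g x) μ → 𝔼 f μ ≡ 𝔼 g μ
    𝔼-cong eqs = ∑-cong (All.map (λ { {x , p} eq → cong (p *_) eq }) eqs)

    𝔼-+ : ∀ (f g : A → ℚ) μ → 𝔼 (λ x → f x + g x) μ ≡ 𝔼 f μ + 𝔼 g μ
    𝔼-+ f g μ = trans (∑-cong (All.universal (λ (x , p) → *-distribˡ-+ p (f x) (g x)) μ))
                      (∑-+ (λ (x , p) → p * f x) (λ (x , p) → p * g x) μ)

    𝔼-*ʳ : ∀ (f : A → ℚ) c μ → 𝔼 (λ x → f x * c) μ ≡ 𝔼 f μ * c
    𝔼-*ʳ f c μ = trans (∑-cong (All.universal (λ (x , p) → solve 3 (λ p y c → p :* (y :* c) := c :* (p :* y)) refl p (f x) c) μ))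
      (trans (∑-* c (λ (x , p) → p * f x) μ) (*-comm c (𝔼 f μ)))

    𝔼-return : ∀ (f : A → ℚ) x → 𝔼 f (return x) ≡ f x
    𝔼-return f x = solve 1 (λ y → con 1ℚ :* y :+ con 0ℚ := y) refl (f x)

    -- The length of the tail appears because `inv` is shifted by one.
    𝔼-uniform : ∀ (f : A → ℚ) (xs : List⁺ A) → 𝔼 f (uniform xs) ≡ inv (length (List⁺.tail xs)) * ∑ f (toList xs)
    𝔼-uniform f xs = trans (∑-map (λ (x , p) → p * f x) (λ x → x , + 1 / List⁺.length xs) (toList xs))
      (trans (∑-* (+ 1 / List⁺.length xs) f (toList xs)) (cong (_* ∑ f (toList xs)) (1/≡inv (length (List⁺.tail xs)))))

  module _ {A B : Set} where

    𝔼-bind : ∀ (f : B → ℚ) (μ : Dist A) (κ : A → Dist B) → 𝔼 f (μ >>= κ) ≡ 𝔼 (λ x → 𝔼 f (κ x)) μ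
    𝔼-bind f []            κ = refl
    𝔼-bind f ((x , p) ∷ μ) κ = trans (∑-++ (λ (y , r) → r * f y) (map (λ (y , r) → y , p * r) (κ x)) (μ >>= κ))
      (cong₂ _+_
        (trans (∑-map (λ (y , r) → r * f y) (λ (y , r) → y , p * r) (κ x))
          (trans (∑-cong (All.universal (λ (y , r) → *-assoc p r (f y)) (κ x))) (∑-* p (λ (y , r) → r * f y) (κ x))))
        (𝔼-bind f μ κ))

    All-bind : ∀ {P : A → Set} {R : B → Set} {μ : Dist A} {κ : A → Dist B} → All (P ∘ proj₁) μ →
               (∀ x → P x → All (R ∘ proj₁) (κ x)) → All (R ∘ proj₁) (μ >>= κ)
    All-bind                 []        h = []
    All-bind {μ = (x , p) ∷ μ} (px ∷ pxs) h = All.++⁺ (All.map⁺ (h x px)) (All-bind pxs h)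

  next : ∀ {n} → Graph n → Dist (Graph (suc n))
  next G = uniform (edges G) >>= λ e → return (attach G e)

  uniform-support : ∀ {A : Set} (xs : List⁺ A) → All ((_∈ toList xs) ∘ proj₁) (uniform xs)
  uniform-support xs = All.map⁺ (All.tabulate id)

  process-invariant : ∀ t → All (Invariant t ∘ proj₁) (process t)
  process-invariant zero    = invariant-singleEdge ∷ []
  process-invariant (suc t) = All-bind (process-invariant t) λ G inv →
    All-bind (uniform-support (edges G)) λ e e∈G → invariant-attach inv e∈G ∷ []

  𝔼-next : ∀ {n} (f : Graph (suc n) → ℚ) (G : Graph n) →
           𝔼 f (next G) ≡ inv (length (List⁺.tail (edges G))) * ∑ (λ e → f (attach G e)) (toList (edges G))
  𝔼-next f G = trans (𝔼-bind f (uniform (edges G)) (λ e → return (attach G e)))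
    (trans (𝔼-uniform (λ e → 𝔼 f (return (attach G e))) (edges G))
      (cong (inv (length (List⁺.tail (edges G))) *_)
        (∑-cong (All.universal (λ e → 𝔼-return f (attach G e)) (toList (edges G))))))

  process-mass : ∀ t c → 𝔼 (λ _ → c) (process t) ≡ c
  process-mass zero    c = 𝔼-return (λ _ → c) singleEdge
  process-mass (suc t) c = trans (𝔼-bind (λ _ → c) (process t) next)
    (trans (𝔼-cong (All.universal (λ (G , _) → next-mass G) (process t))) (process-mass t c))
    where
    next-mass : ∀ {n} (G : Graph n) → 𝔼 (λ _ → c) (next G) ≡ c
    next-mass G = begin
      𝔼 (λ _ → c) (next G)             ≡⟨ 𝔼-next (λ _ → c) G ⟩
      i * ∑ (λ _ → c) (toList (edges G)) ≡⟨ cong (i *_) (∑-const c (toList (edges G))) ⟩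
      i * (q (suc m) * c)              ≡⟨ solve 3 (λ i n c → i :* (n :* c) := n :* i :* c) refl i (q (suc m)) c ⟩
      q (suc m) * i * c                ≡⟨ cong (_* c) (inv-cancel m) ⟩
      1ℚ * c                           ≡⟨ *-identityˡ c ⟩
      c                                ∎
      where
      open ≡-Reasoning
      m = length (List⁺.tail (edges G))
      i = inv m

  degreeSum : ∀ {n} → (ℕ → ℚ) → Graph n → ℚ
  degreeSum {n} g G = ∑ (λ i → g (degree G i)) (allFin n)

  module _ (g : ℕ → ℚ) where

    Δ : ℕ → ℚ
    Δ d = g (suc d) - g d

    -- Makes the new value affine in the indicator, so that the sum over the chosen edge reaches
    -- only the indicator.
    g-indicator : ∀ {P : Set} (p : Dec P) d → g (indicator p ℕ.+ d) ≡ g d + q (indicator p) * Δ d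
    g-indicator (yes _) d = trans (solve 2 (λ x y → y := x :+ con 1ℚ :* (y :- x)) refl (g d) (g (suc d)))
      (cong (λ k → g d + k * Δ d) (/1≡q 1))
    g-indicator (no _) d = trans (solve 2 (λ x y → x := x :+ con 0ℚ :* y) refl (g d) (Δ d))
      (cong (λ k → g d + k * Δ d) (sym q-zero))

    degreeSum-attach : ∀ {n} (G : Graph n) e → degreeSum g (attach G e) ≡
      degreeSum g G + g 2 + ∑ (λ i → q (indicator (end? e i)) * Δ (degree G i)) (allFin n)
    degreeSum-attach {n} G e = begin
      ∑ g′ (allFin (suc n))
        ≡⟨ cong (∑ g′) (allFin-suc n) ⟩
      ∑ g′ (map inject₁ (allFin n) ++ (fromℕ n ∷ []))
        ≡⟨ ∑-++ g′ (map inject₁ (allFin n)) (fromℕ n ∷ []) ⟩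
      ∑ g′ (map inject₁ (allFin n)) + (g′ (fromℕ n) + 0ℚ)
        ≡⟨ cong₂ (λ x d → x + (g d + 0ℚ)) (trans (∑-map g′ inject₁ (allFin n))
             (trans (∑-cong (All.universal old (allFin n))) (∑-+ (λ i → g (degree G i)) change (allFin n)))) degree-new ⟩
      degreeSum g G + ∑ change (allFin n) + (g 2 + 0ℚ)
        ≡⟨ solve 3 (λ a b c → a :+ b :+ (c :+ con 0ℚ) := a :+ c :+ b) refl (degreeSum g G) (∑ change (allFin n)) (g 2) ⟩
      degreeSum g G + g 2 + ∑ change (allFin n) ∎
      where
      open ≡-Reasoning
      open Attach G e
      g′ : Fin (suc n) → ℚ
      g′ i = g (degree G′ i)
      change : Fin n → ℚ
      change i = q (indicator (end? e i)) * Δ (degree G i)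
      old : ∀ i → g′ (inject₁ i) ≡ g (degree G i) + change i
      old i = trans (cong g (degree-old i)) (g-indicator (end? e i) (degree G i))

    -- Double counting: after exchanging the sums, vertex i is weighted by the number of edges
    -- ending at it, which is its degree.
    ∑-ends : ∀ {t} {G : Graph (2 ℕ.+ t)} → Invariant t G →
             ∑ (λ e → ∑ (λ i → q (indicator (end? e i)) * Δ (degree G i)) (allFin (2 ℕ.+ t))) (toList (edges G)) ≡
             ∑ (λ i → q (degree G i) * Δ (degree G i)) (allFin (2 ℕ.+ t))
    ∑-ends {t} {G} inv = trans (∑-swap (λ e i → q (indicator (end? e i)) * Δ (degree G i)) es (allFin (2 ℕ.+ t)))
      (∑-cong (All.universal at (allFin (2 ℕ.+ t))))
      where
      open ≡-Reasoning
      es = toList (edges G)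
      at : ∀ i → ∑ (λ e → q (indicator (end? e i)) * Δ (degree G i)) es ≡ q (degree G i) * Δ (degree G i)
      at i = begin
        ∑ (λ e → q (indicator (end? e i)) * Δ (degree G i)) es
          ≡⟨ ∑-cong (All.universal (λ e → *-comm (q (indicator (end? e i))) (Δ (degree G i))) es) ⟩
        ∑ (λ e → Δ (degree G i) * q (indicator (end? e i))) es
          ≡⟨ ∑-* (Δ (degree G i)) (λ e → q (indicator (end? e i))) es ⟩
        Δ (degree G i) * ∑ (λ e → q (indicator (end? e i))) es
          ≡⟨ cong (Δ (degree G i) *_) (trans (∑-indicator (λ e → end? e i) es) (cong q (incidence≡deg inv i))) ⟩
        Δ (degree G i) * q (degree G i)
          ≡⟨ *-comm (Δ (degree G i)) (q (degree G i)) ⟩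
        q (degree G i) * Δ (degree G i) ∎

    -- The number of edges is deterministic, so the conditional expectation is again a degree sum,
    -- with coefficients depending on t only.
    𝔼-degreeSum-next : ∀ {t} {G : Graph (2 ℕ.+ t)} → Invariant t G →
                       𝔼 (degreeSum g) (next G) ≡ degreeSum (growth t g) G + g 2
    𝔼-degreeSum-next {t} {G} invariant = begin
      𝔼 (degreeSum g) (next G)
        ≡⟨ 𝔼-next (degreeSum g) G ⟩
      inv (length (List⁺.tail (edges G))) * ∑ (λ e → degreeSum g (attach G e)) es
        ≡⟨ cong₂ (λ k x → inv k * x) (ℕ.suc-injective (edgeCount invariant))
             (trans (∑-cong (All.universal (degreeSum-attach G) es))
               (trans (∑-+ (λ _ → w) (λ e → ∑ (λ i → q (indicator (end? e i)) * Δ (degree G i)) vs) es)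
                 (cong₂ _+_ (trans (∑-const w es) (cong (λ k → q k * w) (edgeCount invariant))) (∑-ends invariant)))) ⟩
      o t * (q (suc (2 ℕ.* t)) * w + d)
        ≡⟨ solve 4 (λ o n w d → o :* (n :* w :+ d) := n :* o :* w :+ o :* d) refl (o t) (q (suc (2 ℕ.* t))) w d ⟩
      q (suc (2 ℕ.* t)) * o t * w + o t * d
        ≡⟨ cong (λ x → x * w + o t * d) (inv-cancel (2 ℕ.* t)) ⟩
      1ℚ * (degreeSum g G + g 2) + o t * d
        ≡⟨ solve 3 (λ a b c → con 1ℚ :* (a :+ b) :+ c := a :+ c :+ b) refl (degreeSum g G) (g 2) (o t * d) ⟩
      degreeSum g G + o t * d + g 2
        ≡⟨ cong (λ x → degreeSum g G + x + g 2) (∑-* (o t) (λ i → q (degree G i) * Δ (degree G i)) vs) ⟨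
      degreeSum g G + ∑ (λ i → o t * (q (degree G i) * Δ (degree G i))) vs + g 2
        ≡⟨ cong (_+ g 2) (∑-+ (λ i → g (degree G i)) (λ i → o t * (q (degree G i) * Δ (degree G i))) vs) ⟨
      degreeSum (growth t g) G + g 2 ∎
      where
      open ≡-Reasoning
      es = toList (edges G)
      vs = allFin (2 ℕ.+ t)
      w = degreeSum g G + g 2
      d = ∑ (λ i → q (degree G i) * Δ (degree G i)) vs

  -- The induction must hold for all g at once, because a step back in time replaces g by
  -- `growth t g`; `count-step` mirrors this on the side of the counts.
  𝔼-degreeSum : ∀ t g → 𝔼 (degreeSum g) (process t) ≡ S (λ d → count t d * g d) (2 ℕ.+ t)
  𝔼-degreeSum zero g = solve 2 (λ x y → con 1ℚ :* (y :+ (y :+ con 0ℚ)) :+ con 0ℚ := con 0ℚ :+ con 0ℚ :* x :+ con 2ℚ :* y)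
    refl (g 0) (g 1)
  𝔼-degreeSum (suc t) g = begin
    𝔼 (degreeSum g) (process (suc t))
      ≡⟨ 𝔼-bind (degreeSum g) (process t) next ⟩
    𝔼 (λ G → 𝔼 (degreeSum g) (next G)) (process t)
      ≡⟨ 𝔼-cong (All.map (λ {x} → 𝔼-degreeSum-next g {G = proj₁ x}) (process-invariant t)) ⟩
    𝔼 (λ G → degreeSum (growth t g) G + g 2) (process t)
      ≡⟨ 𝔼-+ (degreeSum (growth t g)) (λ _ → g 2) (process t) ⟩
    𝔼 (degreeSum (growth t g)) (process t) + 𝔼 (λ _ → g 2) (process t)
      ≡⟨ cong₂ _+_ (𝔼-degreeSum t (growth t g)) (process-mass t (g 2)) ⟩
    S (λ d → count t d * growth t g d) (2 ℕ.+ t) + g 2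
      ≡⟨ count-step t g ⟨
    S (λ d → count (suc t) d * g d) (3 ℕ.+ t) ∎
    where open ≡-Reasoning

  𝔼-averageClustering : ∀ t → 𝔼 averageClustering (process t) ≡ expected t
  𝔼-averageClustering t = begin
    𝔼 averageClustering (process t)
      ≡⟨ 𝔼-cong (All.map (λ {x} → average {proj₁ x}) (process-invariant t)) ⟩
    𝔼 (λ G → degreeSum clustering G * inv (1 ℕ.+ t)) (process t)
      ≡⟨ 𝔼-*ʳ (degreeSum clustering) (inv (1 ℕ.+ t)) (process t) ⟩
    𝔼 (degreeSum clustering) (process t) * inv (1 ℕ.+ t)
      ≡⟨ cong (_* inv (1 ℕ.+ t)) (𝔼-degreeSum t clustering) ⟩
    expected t ∎
    where
    open ≡-Reasoning
    average : ∀ {G : Graph (2 ℕ.+ t)} → Invariant t G → averageClustering G ≡ degreeSum clustering G * inv (1 ℕ.+ t)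
    average {G} invariant = cong₂ _*_ (∑-cong (All.universal local (allFin (2 ℕ.+ t)))) (1/≡inv (1 ℕ.+ t))
      where
      local : ∀ i → localClustering G i ≡ clustering (degree G i)
      local i = cong (clusteringFormula (degree G i)) (sym (cong ℕ.pred (degree≡suc invariant i)))

open import Defs
open import Data.Integer using (+_)
open import Data.Rational using (_/_)

-- From a rational null sequence to convergence in the reals

module Conclusion where

  open +-*-Solver using (solve; _:+_; _:*_; _:-_; _:=_; con)
  open Rationals using (Null; Null-cong)
  open DegreeLaw using (expected; expected-limit)
  open Expectation using (𝔼-averageClustering)

  value : ℝ
  value = fromℚ (+ 2 / 1) * (π * π) - fromℚ (+ 19 / 1)

  -- The t-th approximation of the limit is 2 (4 l)² - 19 with l the Leibniz sum of t terms, whence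
  -- the coefficient 32 in the rational estimates.
  diagonal : Null (λ t → 𝔼 averageClustering (process t) ℚ.- approx value t)
  diagonal = Null-cong {λ t → expected t ℚ.- target (leibnizSum t)} {λ t → 𝔼 averageClustering (process t) ℚ.- approx value t}
    (λ t → sym (cong₂ ℚ._-_ (𝔼-averageClustering t) (eq (leibnizSum t)))) expected-limit
    where
    target : ℚ.ℚ → ℚ.ℚ
    target l = (+ 32 / 1) ℚ.* (l ℚ.* l) ℚ.- (+ 19 / 1)
    eq : ∀ l → (+ 2 / 1) ℚ.* ((+ 4 / 1) ℚ.* l ℚ.* ((+ 4 / 1) ℚ.* l)) ℚ.- (+ 19 / 1) ≡ target l
    eq = solve 1 (λ l → con (+ 2 / 1) :* (con (+ 4 / 1) :* l :* (con (+ 4 / 1) :* l)) :- con (+ 19 / 1) :=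
                        con (+ 32 / 1) :* (l :* l) :- con (+ 19 / 1)) refl

  -- Convergence compares `a t` with the approximations of x at all late n, not only at n = t. The
  -- Cauchy property of x bridges the indices t and n at the cost of ε/2, and its N serves for every
  -- slack δ.
  diagonal⇒⟶ : ∀ (a : ℕ → ℚ.ℚ) (x : ℝ) → Null (λ t → a t ℚ.- approx x t) → (λ t → fromℚ (a t)) ⟶ x
  diagonal⇒⟶ a x null ε ε>0
    with M , hM ← null (ε ℚ.* ℚ.½) (Bounds.half ε ε>0)
       | N , hN ← cauchy x (ε ℚ.* ℚ.½) (Bounds.half ε ε>0) = M ℕ.⊔ N , λ t t≥ δ δ>0 → N , λ n n≥N → begin
    ℚ.∣ a t ℚ.- approx x n ∣
      ≡⟨ cong ℚ.∣_∣ (solve 3 (λ a b c → a :- c := (a :- b) :+ (b :- c)) refl (a t) (approx x t) (approx x n)) ⟩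
    ℚ.∣ (a t ℚ.- approx x t) ℚ.+ (approx x t ℚ.- approx x n) ∣
      ≤⟨ ℚ.∣p+q∣≤∣p∣+∣q∣ (a t ℚ.- approx x t) (approx x t ℚ.- approx x n) ⟩
    ℚ.∣ a t ℚ.- approx x t ∣ ℚ.+ ℚ.∣ approx x t ℚ.- approx x n ∣
      ≤⟨ ℚ.+-mono-≤ (hM t (ℕ.m⊔n≤o⇒m≤o M N t≥)) (ℚ.<⇒≤ (hN t n (ℕ.m⊔n≤o⇒n≤o M N t≥) n≥N)) ⟩
    ε ℚ.* ℚ.½ ℚ.+ ε ℚ.* ℚ.½
      ≡⟨ Bounds.half+half ε ⟩
    ε
      ≡⟨ ℚ.+-identityʳ ε ⟨
    ε ℚ.+ ℚ.0ℚ
      ≤⟨ ℚ.+-monoʳ-≤ ε (ℚ.<⇒≤ δ>0) ⟩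
    ε ℚ.+ δ ∎
    where open ℚ.≤-Reasoning

theorem8 : (λ t → fromℚ (𝔼 averageClustering (process t))) ⟶ fromℚ (+ 2 / 1) * (π * π) - fromℚ (+ 19 / 1)
theorem8 = Conclusion.diagonal⇒⟶ (λ t → 𝔼 averageClustering (process t)) Conclusion.value Conclusion.diagonal
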